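{- For all positive integers $a\leq b$, the complete bipartite graph $K_{a,b}$ satisfies \[\tfrac{1}{2}(a+b-1)\;\leq\;\operatorname{sn}(K_{a,b})\;\leq\;\min\Big\{b,\ \big\lceil \tfrac{b}{2}\big\rceil+a-1\Big\}.\]
   Context: A (straight-line) drawing of a graph maps its vertices to distinct points in the plane and represents each edge by the closed line segment between its endpoints, such that each edge segment intersects no vertex other than its own endpoints. The slope of an edge is the angle in $[0,\pi)$ from the $x$-axis to the line containing it. The slope-number $\operatorname{sn}(G)$ is the minimum number of distinct edge slopes over all drawings of $G$. -}

module Defs where

open import Level using (0ℓ)
open import Data.Nat using (ℕ)
open import Data.Fin using (Fin)
open import Data.Product using (Σ; ∃; _×_; _,_; proj₁; proj₂)
open import Data.Sum using (_⊎_)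
open import Relation.Nullary using (¬_)
open import Relation.Binary.PropositionalEquality using (_≡_)
open import Algebra.Structures using (IsCommutativeRing)
open import Relation.Binary.Structures using (IsTotalOrder)

-- The real numbers, axiomatised as a complete ordered field
-- (unique up to isomorphism; the theorem quantifies over any model).
record CompleteOrderedField : Set₁ where
  infix  4 _≈_ _≤_
  infixl 6 _+_ _-_
  infixl 7 _*_
  field
    Carrier : Set
    _≈_     : Carrier → Carrier → Set
    _+_ _*_ : Carrier → Carrier → Carrier
    -_      : Carrier → Carrier
    0# 1#   : Carrier
    isCommutativeRing : IsCommutativeRing _≈_ _+_ _*_ -_ 0# 1#
    0≉1     : ¬ (0# ≈ 1#)
    inverse : ∀ x → ¬ (x ≈ 0#) → ∃ λ y → x * y ≈ 1#
    _≤_     : Carrier → Carrier → Set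
    isTotalOrder : IsTotalOrder _≈_ _≤_
    +-mono  : ∀ x y z → x ≤ y → x + z ≤ y + z
    *-nonneg : ∀ x y → 0# ≤ x → 0# ≤ y → 0# ≤ x * y
    complete : (P : Carrier → Set) → ∃ P →
               (∃ λ u → ∀ x → P x → x ≤ u) →
               ∃ λ s → (∀ x → P x → x ≤ s) × (∀ u → (∀ x → P x → x ≤ u) → s ≤ u)

  _-_ : Carrier → Carrier → Carrier
  x - y = x + (- y)

record Graph : Set₁ where
  field
    V    : Set
    E    : Set
    ends : E → V × V

K : ℕ → ℕ → Graph
K a b = record { V = Fin a ⊎ Fin b ; E = Fin a × Fin b
               ; ends = λ { (i , j) → (_⊎_.inj₁ i , _⊎_.inj₂ j) } }

module _ (R : CompleteOrderedField) where
  open CompleteOrderedField R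

  Point : Set
  Point = Carrier × Carrier

  _≉ₚ_ : Point → Point → Set
  p ≉ₚ q = ¬ ((proj₁ p ≈ proj₁ q) × (proj₂ p ≈ proj₂ q))

  OnSegment : Point → Point → Point → Set
  OnSegment w p q = ∃ λ t → (0# ≤ t) × (t ≤ 1#) ×
    (proj₁ w ≈ proj₁ p + t * (proj₁ q - proj₁ p)) ×
    (proj₂ w ≈ proj₂ p + t * (proj₂ q - proj₂ p))

  SameSlope : Point → Point → Point → Point → Set
  SameSlope p q r s =
    (proj₁ q - proj₁ p) * (proj₂ s - proj₂ r) ≈ (proj₂ q - proj₂ p) * (proj₁ s - proj₁ r)

  record Drawing (G : Graph) : Set where
    open Graph G
    field
      pos      : V → Point
      distinct : ∀ v w → ¬ (v ≡ w) → pos v ≉ₚ pos w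
      noHit    : ∀ e w → ¬ (w ≡ proj₁ (ends e)) → ¬ (w ≡ proj₂ (ends e)) →
                 ¬ OnSegment (pos w) (pos (proj₁ (ends e))) (pos (proj₂ (ends e)))

  AtMostSlopes : {G : Graph} → Drawing G → ℕ → Set
  AtMostSlopes {G} D k = ∃ λ (c : Graph.E G → Fin k) → ∀ e f → c e ≡ c f →
      SameSlope (pos (proj₁ (ends e))) (pos (proj₂ (ends e)))
                (pos (proj₁ (ends f))) (pos (proj₂ (ends f)))
    where open Graph G ; open Drawing D

  SlopeNumber≤ : Graph → ℕ → Set
  SlopeNumber≤ G k = Σ (Drawing G) λ D → AtMostSlopes D k

{-# OPTIONS --safe #-}
-- Lower bound.  Let o be the lexicographically smallest point of A, and split B
-- into the points to the left and to the right of o.  The edges from o to the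
-- right part have distinct slopes.  Ordering directions by slope, the matrix of
-- slopes of the edges between A and the left part of B has a saddle point (v , x):
-- by (v - x) + (w - y) = (w - x) + (v - y), no two entries on a diagonal of a 2 × 2
-- minor both exceed the two others.  All edges from x to A have slope at most that
-- of vx and all edges from v to the left part have slope at least that of vx, so
-- together these are another |A| + |left part| - 1 distinct slopes.
--
-- Upper bound ⌈b/2⌉ + a - 1.  Put A on the line y = 0 and half of B on each of the
-- lines y = 1 and y = -1, all at consecutive integer abscissas.
--
-- Upper bound b.  Let A and B alternate along an affinely regular 2b-gon, in which
-- chords P_i P_j and P_k P_l with i + j ≡ k + l (mod 2b) are parallel.  It lives on
-- the conic x² - τxy + y² = 1 with τ = 2 cos (π/b), which is obtained as a supremum.
module Submission where

open import Defs
open import Level using (0ℓ)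
open import Algebra.Bundles using (CommutativeRing)
import Algebra.Properties.Ring as RingProperties
import Algebra.Properties.Semiring.Mult.TCOptimised as Mult
import Algebra.Solver.Ring as RingSolver
open import Algebra.Solver.Ring.AlmostCommutativeRing using (fromCommutativeRing; _-Raw-AlmostCommutative⟶_)
open import Data.Empty using (⊥-elim)
open import Data.Fin using (Fin; zero; suc; toℕ; fromℕ<; inject≤; opposite; punchIn; splitAt; join; _≟_)
open import Data.Fin.Properties using (injective⇒≤; inject≤-injective; join-splitAt; opposite-prop; punchIn-injective; punchInᵢ≢i; splitAt-join; toℕ-fromℕ<; toℕ-injective; toℕ<n; toℕ≤pred[n])
import Data.Integer as ℤ
import Data.Integer.Properties as ℤ
import Data.Maybe as Maybe
open import Data.Nat using (ℕ; zero; suc)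
import Data.Nat as ℕ
import Data.Nat.DivMod as ℕ
import Data.Nat.Properties as ℕ
open import Data.Nat.Tactic.RingSolver using (solve-∀)
open import Data.Product using (∃; _×_; _,_; proj₁; proj₂)
open import Data.Sum as Sum using (_⊎_; inj₁; inj₂; reduce)
open import Data.Sum.Properties using (inj₁-injective; inj₂-injective)
open import Data.Unit using (⊤; tt)
open import Function using (Injective; _∘_; case_of_; id)
open import Relation.Binary.Definitions using (tri<; tri≈; tri>)
open import Relation.Binary.PropositionalEquality as ≡ using (_≡_; _≢_)
open import Relation.Binary.Structures using (IsTotalOrder)
open import Relation.Nullary using (¬_; Dec; yes; no)
open import Relation.Nullary.Decidable using (dec⇒maybe)

-- Minima over decidable subsets of a finite set

-- Totality and transitivity are asked only on `P`, because comparing slopes by determinants is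
-- transitive only within a half plane of directions.
argmin : ∀ {n} {P : Fin n → Set} {_≼_ : Fin n → Fin n → Set} → (∀ i → Dec (P i)) →
  (∀ i j → P i → P j → i ≼ j ⊎ j ≼ i) →
  (∀ {i j k} → P i → P j → P k → i ≼ j → j ≼ k → i ≼ k) →
  (∃ λ i → P i × ∀ j → P j → i ≼ j) ⊎ (∀ i → ¬ P i)
argmin {zero} P? ≼-total ≼-trans = inj₂ λ ()
argmin {suc n} {P} {_≼_} P? ≼-total ≼-trans
  with argmin {P = P ∘ suc} {λ i j → suc i ≼ suc j} (P? ∘ suc) (λ i j → ≼-total (suc i) (suc j)) ≼-trans
     | P? zero
... | inj₂ none | no ¬P0 = inj₂ λ { zero → ¬P0 ; (suc i) → none i }
... | inj₂ none | yes P0 = inj₁ (zero , P0 , λ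
        { zero _ → reduce (≼-total zero zero P0 P0) ; (suc j) Pj → ⊥-elim (none j Pj) })
... | inj₁ (i , Pi , min) | no ¬P0 = inj₁ (suc i , Pi , λ
        { zero P0 → ⊥-elim (¬P0 P0) ; (suc j) → min j })
... | inj₁ (i , Pi , min) | yes P0 with ≼-total zero (suc i) P0 Pi
...   | inj₂ i≼0 = inj₁ (suc i , Pi , λ { zero _ → i≼0 ; (suc j) → min j })
...   | inj₁ 0≼i = inj₁ (zero , P0 , λ
          { zero _ → reduce (≼-total zero zero P0 P0)
          ; (suc j) Pj → ≼-trans P0 Pi Pj 0≼i (min j Pj) })

module Plane (R : CompleteOrderedField) where
  open CompleteOrderedField R

  commutativeRing : CommutativeRing 0ℓ 0ℓ
  commutativeRing = record { isCommutativeRing = isCommutativeRing }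

  open CommutativeRing commutativeRing
    using (setoid; refl; sym; trans; reflexive; +-cong; +-congˡ; +-congʳ; *-cong; *-congˡ; *-congʳ; -‿cong; semiring; ring)
  open import Relation.Binary.Reasoning.Setoid setoid

  open Mult semiring using (×-homo-+; ×1-homo-*) renaming (_×_ to _·_)

  fromℕ : ℕ → Carrier
  fromℕ n = n · 1#

  -- Polynomial identities with integer coefficients

  module Solver where
    open CommutativeRing commutativeRing using (+-identityˡ; +-identityʳ; +-comm; +-assoc)
    open RingProperties ring

    -- Coefficients are integers because their equality is decidable, whereas equality in `Carrier`
    -- has not been decided at this point.
    fromℤ : ℤ.ℤ → Carrier
    fromℤ (ℤ.+ n)     = fromℕ n
    fromℤ ℤ.-[1+ n ] = - fromℕ (suc n)

    neg-homo : ∀ i → fromℤ (ℤ.- i) ≈ - fromℤ i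
    neg-homo (ℤ.+ zero)    = sym -0#≈0#
    neg-homo (ℤ.+ (suc n)) = refl
    neg-homo ℤ.-[1+ n ]    = sym (-‿involutive _)

    fromℕ-+ : ∀ m n → fromℕ (m ℕ.+ n) ≈ fromℕ m + fromℕ n
    fromℕ-+ = ×-homo-+ 1#

    fromℕ-suc : ∀ n → fromℕ (suc n) ≈ 1# + fromℕ n
    fromℕ-suc n = fromℕ-+ 1 n

    ⊖-homo : ∀ m n → fromℤ (m ℤ.⊖ n) ≈ fromℕ m - fromℕ n
    ⊖-homo m       zero    = sym (trans (+-congˡ -0#≈0#) (+-identityʳ _))
    ⊖-homo zero    (suc n) = sym (+-identityˡ _)
    ⊖-homo (suc m) (suc n) = begin
      fromℤ (suc m ℤ.⊖ suc n)                 ≡⟨ ≡.cong fromℤ (ℤ.[1+m]⊖[1+n]≡m⊖n m n) ⟩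
      fromℤ (m ℤ.⊖ n)                         ≈⟨ ⊖-homo m n ⟩
      fromℕ m - fromℕ n                       ≈⟨ +-congˡ (xyx⁻¹≈y 1# (- fromℕ n)) ⟨
      fromℕ m + (1# + - fromℕ n + - 1#)       ≈⟨ +-congˡ (trans (+-assoc 1# _ _) (+-congˡ (+-comm _ _))) ⟩
      fromℕ m + (1# + (- 1# + - fromℕ n))     ≈⟨ +-assoc _ _ _ ⟨
      fromℕ m + 1# + (- 1# + - fromℕ n)       ≈⟨ +-cong (+-comm _ _) (-‿+-comm 1# (fromℕ n)) ⟩
      (1# + fromℕ m) - (1# + fromℕ n)         ≈⟨ +-cong (fromℕ-suc m) (-‿cong (fromℕ-suc n)) ⟨
      fromℕ (suc m) - fromℕ (suc n)           ∎

    +-homo : ∀ i j → fromℤ (i ℤ.+ j) ≈ fromℤ i + fromℤ j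
    +-homo (ℤ.+ m)     (ℤ.+ n)     = ×-homo-+ 1# m n
    +-homo (ℤ.+ m)     ℤ.-[1+ n ] = ⊖-homo m (suc n)
    +-homo ℤ.-[1+ m ] (ℤ.+ n)     = trans (⊖-homo n (suc m)) (+-comm _ _)
    +-homo ℤ.-[1+ m ] ℤ.-[1+ n ] = begin
      - fromℕ (suc (suc (m ℕ.+ n)))     ≡⟨ ≡.cong (λ l → - fromℕ l) (≡.cong suc (ℕ.+-suc m n)) ⟨
      - fromℕ (suc m ℕ.+ suc n)         ≈⟨ -‿cong (×-homo-+ 1# (suc m) (suc n)) ⟩
      - (fromℕ (suc m) + fromℕ (suc n)) ≈⟨ -‿+-comm _ _ ⟨
      - fromℕ (suc m) - fromℕ (suc n)   ∎

    pos-*-homo : ∀ m j → fromℤ (ℤ.+ m ℤ.* j) ≈ fromℕ m * fromℤ j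
    pos-*-homo m (ℤ.+ n) = trans (reflexive (≡.cong fromℤ (≡.sym (ℤ.pos-* m n)))) (×1-homo-* m n)
    pos-*-homo m ℤ.-[1+ n ] = begin
      fromℤ (ℤ.+ m ℤ.* ℤ.-[1+ n ])         ≡⟨ ≡.cong fromℤ (ℤ.neg-distribʳ-* (ℤ.+ m) (ℤ.+ suc n)) ⟨
      fromℤ (ℤ.- (ℤ.+ m ℤ.* ℤ.+ suc n))    ≈⟨ neg-homo (ℤ.+ m ℤ.* ℤ.+ suc n) ⟩
      - fromℤ (ℤ.+ m ℤ.* ℤ.+ suc n)        ≈⟨ -‿cong (pos-*-homo m (ℤ.+ suc n)) ⟩
      - (fromℕ m * fromℕ (suc n))          ≈⟨ -‿distribʳ-* _ _ ⟩
      fromℕ m * - fromℕ (suc n)            ∎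

    *-homo : ∀ i j → fromℤ (i ℤ.* j) ≈ fromℤ i * fromℤ j
    *-homo (ℤ.+ m)     j = pos-*-homo m j
    *-homo ℤ.-[1+ m ] j = begin
      fromℤ (ℤ.-[1+ m ] ℤ.* j)        ≡⟨ ≡.cong fromℤ (ℤ.neg-distribˡ-* (ℤ.+ suc m) j) ⟨
      fromℤ (ℤ.- (ℤ.+ suc m ℤ.* j))   ≈⟨ neg-homo (ℤ.+ suc m ℤ.* j) ⟩
      - fromℤ (ℤ.+ suc m ℤ.* j)       ≈⟨ -‿cong (pos-*-homo (suc m) j) ⟩
      - (fromℕ (suc m) * fromℤ j)     ≈⟨ -‿distribˡ-* _ _ ⟩
      - fromℕ (suc m) * fromℤ j       ∎

    morphism : ℤ.+-*-rawRing -Raw-AlmostCommutative⟶ fromCommutativeRing commutativeRing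
    morphism = record
      { ⟦_⟧ = fromℤ ; +-homo = +-homo ; *-homo = *-homo ; -‿homo = neg-homo
      ; 0-homo = refl ; 1-homo = refl }

    open RingSolver ℤ.+-*-rawRing (fromCommutativeRing commutativeRing) morphism
      (λ i j → Maybe.map (λ i≡j → reflexive (≡.cong fromℤ i≡j)) (dec⇒maybe (i ℤ.≟ j))) public
      using (solve; con; _:=_; _:+_; _:*_; _:-_; :-_; Polynomial)

    :0 :1 : ∀ {n} → Polynomial n
    :0 = con (ℤ.+ 0)
    :1 = con (ℤ.+ 1)

  open Solver using (solve; _:=_; _:+_; _:*_; _:-_; :-_; :0; :1; fromℕ-suc; fromℕ-+)

  -- Arithmetic of inequalities

  open IsTotalOrder isTotalOrder
    using (total; antisym; ≤-respʳ-≈; ≤-respˡ-≈)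
    renaming (refl to ≤-refl; trans to ≤-trans; reflexive to ≤-reflexive)

  ≤⇒0≤- : ∀ {x y} → x ≤ y → 0# ≤ y - x
  ≤⇒0≤- {x} {y} x≤y = ≤-respˡ-≈ (solve 1 (λ x → x :- x := :0) refl x) (+-mono x y (- x) x≤y)

  0≤-⇒≤ : ∀ {x y} → 0# ≤ y - x → x ≤ y
  0≤-⇒≤ {x} {y} 0≤y-x = ≤-respˡ-≈ (solve 1 (λ x → :0 :+ x := x) refl x)
    (≤-respʳ-≈ (solve 2 (λ x y → y :- x :+ x := y) refl x y) (+-mono 0# (y - x) x 0≤y-x))

  ≤0⇒0≤- : ∀ {x} → x ≤ 0# → 0# ≤ - x
  ≤0⇒0≤- {x} x≤0 = ≤-respʳ-≈ (solve 1 (λ x → :0 :- x := :- x) refl x) (≤⇒0≤- x≤0)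

  0≤-⇒≤0 : ∀ {x} → 0# ≤ - x → x ≤ 0#
  0≤-⇒≤0 {x} 0≤-x = 0≤-⇒≤ (≤-respʳ-≈ (solve 1 (λ x → :- x := :0 :- x) refl x) 0≤-x)

  0≤+ : ∀ {x y} → 0# ≤ x → 0# ≤ y → 0# ≤ x + y
  0≤+ {x} {y} 0≤x 0≤y = ≤-trans 0≤y
    (≤-respˡ-≈ (solve 1 (λ y → :0 :+ y := y) refl y) (+-mono 0# x y 0≤x))

  0≤* : ∀ {x y} → 0# ≤ x → 0# ≤ y → 0# ≤ x * y
  0≤* = *-nonneg _ _

  0≤x² : ∀ x → 0# ≤ x * x
  0≤x² x with total 0# x
  ... | inj₁ 0≤x = 0≤* 0≤x 0≤x
  ... | inj₂ x≤0 = ≤-respʳ-≈ (solve 1 (λ x → :- x :* :- x := x :* x) refl x) (0≤* (≤0⇒0≤- x≤0) (≤0⇒0≤- x≤0))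

  0≤1 : 0# ≤ 1#
  0≤1 = ≤-respʳ-≈ (solve 0 (:1 :* :1 := :1) refl) (0≤x² 1#)

  Positive : Carrier → Set
  Positive x = ¬ x ≤ 0#

  1-pos : Positive 1#
  1-pos 1≤0 = 0≉1 (antisym 0≤1 1≤0)

  -≈0⇒≈ : ∀ {x y} → x - y ≈ 0# → x ≈ y
  -≈0⇒≈ {x} {y} x-y≈0 = begin
    x           ≈⟨ solve 2 (λ x y → x := x :- y :+ y) refl x y ⟩
    x - y + y   ≈⟨ +-congʳ x-y≈0 ⟩
    0# + y      ≈⟨ solve 1 (λ y → :0 :+ y := y) refl y ⟩
    y           ∎

  ≈⇒-≈0 : ∀ {x y} → x ≈ y → x - y ≈ 0#
  ≈⇒-≈0 {x} {y} x≈y = trans (+-congʳ x≈y) (solve 1 (λ y → y :- y := :0) refl y)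

  -- Decidability of equality and order

  -- Completeness decides the order: the supremum of {0} ∪ {2 ∣ P} lies below or above 1.
  weak-excluded-middle : (P : Set) → (¬ P) ⊎ (¬ ¬ P)
  weak-excluded-middle P with complete (λ z → z ≈ 0# ⊎ (z ≈ 1# + 1# × P)) (0# , inj₁ refl) (1# + 1# , bounded)
    where
    bounded : ∀ z → z ≈ 0# ⊎ (z ≈ 1# + 1# × P) → z ≤ 1# + 1#
    bounded z (inj₁ z≈0)       = ≤-respˡ-≈ (sym z≈0) (0≤+ 0≤1 0≤1)
    bounded z (inj₂ (z≈2 , _)) = ≤-reflexive z≈2
  ... | s , upper , least with total s 1#
  ...   | inj₁ s≤1 = inj₁ λ p → 1-pos (0≤-⇒≤ (≤-respʳ-≈
            (solve 0 (:1 :- (:1 :+ :1) := :0 :- :1) refl)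
            (≤⇒0≤- (≤-trans (upper _ (inj₂ (refl , p))) s≤1))))
  ...   | inj₂ 1≤s = inj₂ λ ¬p → 1-pos (≤-trans 1≤s (least 0# λ
            { z (inj₁ z≈0)     → ≤-reflexive z≈0
            ; z (inj₂ (_ , p)) → ⊥-elim (¬p p) }))

  -- The elements that are not apart from 0 are closed under addition, so
  -- translating by any of them preserves their supremum.
  ≈0-stable : ∀ x → ¬ ¬ (x ≈ 0#) → x ≈ 0#
  ≈0-stable x ¬¬x≈0 with complete (λ z → ¬ ¬ (z ≈ 0#)) (0# , λ z≉0 → z≉0 refl) (1# , bounded)
    where
    bounded : ∀ z → ¬ ¬ (z ≈ 0#) → z ≤ 1#
    bounded z ¬¬z≈0 with total z 1#
    ... | inj₁ z≤1 = z≤1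
    ... | inj₂ 1≤z = ⊥-elim (¬¬z≈0 λ z≈0 → 1-pos (≤-respʳ-≈ z≈0 1≤z))
  ... | s , upper , least = antisym (≤0 x ¬¬x≈0) (≤-respʳ-≈ (solve 1 (λ x → :- :- x := x) refl x)
          (≤0⇒0≤- (≤0 (- x) λ -x≉0 → ¬¬x≈0 λ x≈0 →
            -x≉0 (trans (-‿cong x≈0) (solve 0 (:- :0 := :0) refl)))))
    where
    ≤0 : ∀ y → ¬ ¬ (y ≈ 0#) → y ≤ 0#
    ≤0 y ¬¬y≈0 = 0≤-⇒≤0 (≤-respʳ-≈ (solve 2 (λ s y → s :- y :- s := :- y) refl s y)
      (≤⇒0≤- (least (s - y) λ z ¬¬z≈0 → 0≤-⇒≤ (≤-respʳ-≈
        (solve 3 (λ s y z → s :- (z :+ y) := s :- y :- z) refl s y z)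
        (≤⇒0≤- (upper (z + y) λ z+y≉0 → ¬¬y≈0 λ y≈0 → ¬¬z≈0 λ z≈0 →
          z+y≉0 (trans (+-cong z≈0 y≈0) (solve 0 (:0 :+ :0 := :0) refl))))))))

  infix 4 _≤?_

  opaque
    _≈0? : ∀ x → Dec (x ≈ 0#)
    x ≈0? with weak-excluded-middle (x ≈ 0#)
    ... | inj₁ x≉0   = no x≉0
    ... | inj₂ ¬¬x≈0 = yes (≈0-stable x ¬¬x≈0)

  opaque
    -- When totality answers `y ≤ x`, antisymmetry reduces the question to whether `x - y` is zero.
    _≤?_ : ∀ x y → Dec (x ≤ y)
    x ≤? y with total x y
    ... | inj₁ x≤y = yes x≤y
    ... | inj₂ y≤x with (x - y) ≈0?
    ...   | yes x-y≈0 = yes (≤-reflexive (-≈0⇒≈ x-y≈0))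
    ...   | no  x-y≉0 = no λ x≤y → x-y≉0 (≈⇒-≈0 (antisym x≤y y≤x))

  -- Strict positivity and cancellation

  pos⇒≥0 : ∀ {x} → Positive x → 0# ≤ x
  pos⇒≥0 {x} x>0 with total x 0#
  ... | inj₁ x≤0 = ⊥-elim (x>0 x≤0)
  ... | inj₂ 0≤x = 0≤x

  pos⇒≉0 : ∀ {x} → Positive x → ¬ x ≈ 0#
  pos⇒≉0 x>0 x≈0 = x>0 (≤-reflexive x≈0)

  pos-resp : ∀ {x y} → x ≈ y → Positive x → Positive y
  pos-resp x≈y x>0 y≤0 = x>0 (≤-respˡ-≈ (sym x≈y) y≤0)

  pos+nonneg : ∀ {x y} → Positive x → 0# ≤ y → Positive (x + y)
  pos+nonneg {x} {y} x>0 0≤y x+y≤0 = x>0 (0≤-⇒≤0 (≤-respʳ-≈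
    (solve 2 (λ x y → :- (x :+ y) :+ y := :- x) refl x y) (0≤+ (≤0⇒0≤- x+y≤0) 0≤y)))

  *-cancel-0 : ∀ {x y} → ¬ x ≈ 0# → x * y ≈ 0# → y ≈ 0#
  *-cancel-0 {x} {y} x≉0 xy≈0 with inverse x x≉0
  ... | x⁻¹ , xx⁻¹≈1 = begin
    y                ≈⟨ solve 1 (λ y → y := :1 :* y) refl y ⟩
    1# * y           ≈⟨ *-congʳ xx⁻¹≈1 ⟨
    x * x⁻¹ * y      ≈⟨ solve 3 (λ x i y → x :* i :* y := i :* (x :* y)) refl x x⁻¹ y ⟩
    x⁻¹ * (x * y)    ≈⟨ *-congˡ xy≈0 ⟩
    x⁻¹ * 0#         ≈⟨ solve 1 (λ i → i :* :0 := :0) refl x⁻¹ ⟩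
    0#               ∎

  pos*pos : ∀ {x y} → Positive x → Positive y → Positive (x * y)
  pos*pos {x} {y} x>0 y>0 xy≤0 =
    pos⇒≉0 y>0 (*-cancel-0 (pos⇒≉0 x>0) (antisym xy≤0 (0≤* (pos⇒≥0 x>0) (pos⇒≥0 y>0))))

  *-cancel-≥0 : ∀ {x y} → Positive x → 0# ≤ x * y → 0# ≤ y
  *-cancel-≥0 {x} {y} x>0 0≤xy with y ≤? 0#
  ... | no  y>0 = pos⇒≥0 y>0
  ... | yes y≤0 = ≤-reflexive (sym (*-cancel-0 (pos⇒≉0 x>0) (antisym
    (0≤-⇒≤0 (≤-respʳ-≈ (solve 2 (λ x y → x :* :- y := :- (x :* y)) refl x y) (0≤* (pos⇒≥0 x>0) (≤0⇒0≤- y≤0))))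
    0≤xy)))

  fromℕ-≥0 : ∀ n → 0# ≤ fromℕ n
  fromℕ-≥0 zero    = ≤-refl
  fromℕ-≥0 (suc n) = ≤-respʳ-≈ (sym (fromℕ-suc n)) (0≤+ 0≤1 (fromℕ-≥0 n))

  fromℕ-suc-pos : ∀ n → Positive (fromℕ (suc n))
  fromℕ-suc-pos n = pos-resp (sym (fromℕ-suc n)) (pos+nonneg 1-pos (fromℕ-≥0 n))

  -- Slopes and lexicographic order

  infixl 6 _-ₚ_
  _-ₚ_ : Point R → Point R → Point R
  (p₁ , p₂) -ₚ (q₁ , q₂) = (p₁ - q₁ , p₂ - q₂)

  -- `SameSlope` says that this vanishes on the two edge vectors.
  det : Point R → Point R → Carrier
  det (p₁ , p₂) (q₁ , q₂) = p₁ * q₂ - p₂ * q₁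

  det-antisym : ∀ p q → det q p ≈ - det p q
  det-antisym (p₁ , p₂) (q₁ , q₂) =
    solve 4 (λ p₁ p₂ q₁ q₂ → q₁ :* p₂ :- q₂ :* p₁ := :- (p₁ :* q₂ :- p₂ :* q₁)) refl p₁ p₂ q₁ q₂

  det-total : ∀ p q → 0# ≤ det p q ⊎ 0# ≤ det q p
  det-total p q with total 0# (det p q)
  ... | inj₁ 0≤pq = inj₁ 0≤pq
  ... | inj₂ pq≤0 = inj₂ (≤-respʳ-≈ (sym (det-antisym p q)) (≤0⇒0≤- pq≤0))

  det-swap≈0 : ∀ p q → det p q ≈ 0# → det q p ≈ 0#
  det-swap≈0 p q pq≈0 = trans (det-antisym p q) (trans (-‿cong pq≈0) (solve 0 (:- :0 := :0) refl))

  -- The directions with angle in (-π/2, π/2]. Each line through the origin has exactly one of its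
  -- two directions here, vertical counting as steepest.
  LexPos : Point R → Set
  LexPos (p₁ , p₂) = Positive p₁ ⊎ (p₁ ≈ 0# × Positive p₂)

  lexPos⇒≥0 : ∀ {p} → LexPos p → 0# ≤ proj₁ p
  lexPos⇒≥0 (inj₁ p₁>0)       = pos⇒≥0 p₁>0
  lexPos⇒≥0 (inj₂ (p₁≈0 , _)) = ≤-reflexive (sym p₁≈0)

  lexPos? : ∀ p → Dec (LexPos p)
  lexPos? (p₁ , p₂) with p₁ ≤? 0# | p₁ ≈0? | p₂ ≤? 0#
  ... | no p₁>0  | _        | _        = yes (inj₁ p₁>0)
  ... | yes _    | yes p₁≈0 | no p₂>0  = yes (inj₂ (p₁≈0 , p₂>0))
  ... | yes p₁≤0 | _        | yes p₂≤0 = no λ { (inj₁ p₁>0) → p₁>0 p₁≤0 ; (inj₂ (_ , p₂>0)) → p₂>0 p₂≤0 }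
  ... | yes p₁≤0 | no p₁≉0  | _        = no λ { (inj₁ p₁>0) → p₁>0 p₁≤0 ; (inj₂ (p₁≈0 , _)) → p₁≉0 p₁≈0 }

  neg⇒pos : ∀ {x y} → ¬ (x - y ≈ 0#) → x - y ≤ 0# → Positive (y - x)
  neg⇒pos {x} {y} ≉0 ≤0 y-x≤0 = ≉0 (antisym ≤0
    (≤-respʳ-≈ (solve 2 (λ x y → :- (y :- x) := x :- y) refl x y) (≤0⇒0≤- y-x≤0)))

  lex-total : ∀ p q → _≉ₚ_ R p q → LexPos (q -ₚ p) ⊎ LexPos (p -ₚ q)
  lex-total (p₁ , p₂) (q₁ , q₂) p≉q with (p₁ - q₁) ≈0? | (p₁ - q₁) ≤? 0# | (p₂ - q₂) ≈0? | (p₂ - q₂) ≤? 0#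
  ... | no _   | no >0  | _       | _      = inj₂ (inj₁ >0)
  ... | no ≉0  | yes ≤0 | _       | _      = inj₁ (inj₁ (neg⇒pos ≉0 ≤0))
  ... | yes ≈0 | _      | yes ≈0′ | _      = ⊥-elim (p≉q (-≈0⇒≈ ≈0 , -≈0⇒≈ ≈0′))
  ... | yes ≈0 | _      | no _    | no >0  = inj₂ (inj₂ (≈0 , >0))
  ... | yes ≈0 | _      | no ≉0   | yes ≤0 = inj₁ (inj₂ (≈⇒-≈0 (sym (-≈0⇒≈ ≈0)) , neg⇒pos ≉0 ≤0))

  lex-trans : ∀ p q r → LexPos (q -ₚ p) → LexPos (r -ₚ q) → LexPos (r -ₚ p)
  lex-trans (p₁ , p₂) (q₁ , q₂) (r₁ , r₂) = go
    where
    telescope : ∀ x y z → (y - x) + (z - y) ≈ z - x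
    telescope = solve 3 (λ x y z → (y :- x) :+ (z :- y) := z :- x) refl
    telescope′ : ∀ x y z → (z - y) + (y - x) ≈ z - x
    telescope′ = solve 3 (λ x y z → (z :- y) :+ (y :- x) := z :- x) refl
    go : LexPos ((q₁ , q₂) -ₚ (p₁ , p₂)) → LexPos ((r₁ , r₂) -ₚ (q₁ , q₂)) → LexPos ((r₁ , r₂) -ₚ (p₁ , p₂))
    go (inj₁ >0) r>q = inj₁ (pos-resp (telescope p₁ q₁ r₁) (pos+nonneg >0 (lexPos⇒≥0 r>q)))
    go (inj₂ (≈0 , _)) (inj₁ >0) =
      inj₁ (pos-resp (telescope′ p₁ q₁ r₁) (pos+nonneg >0 (≤-reflexive (sym ≈0))))
    go (inj₂ (≈0 , >0)) (inj₂ (≈0′ , >0′)) =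
      inj₂ ( trans (sym (telescope p₁ q₁ r₁)) (trans (+-cong ≈0 ≈0′) (solve 0 (:0 :+ :0 := :0) refl))
           , pos-resp (telescope p₂ q₂ r₂) (pos+nonneg >0 (pos⇒≥0 >0′)))

  -- On lexicographically positive vectors, 0# ≤ det p q compares slopes.
  det-trans : ∀ {p q r} → LexPos p → LexPos q → LexPos r → 0# ≤ det p q → 0# ≤ det q r → 0# ≤ det p r
  -- The identity q₁ det(p, r) = p₁ det(q, r) + r₁ det(p, q), divided by q₁ > 0.
  det-trans {p₁ , p₂} {q₁ , q₂} {r₁ , r₂} p>0 (inj₁ q₁>0) r>0 pq qr = *-cancel-≥0 q₁>0 (≤-respʳ-≈
    (solve 6 (λ p₁ p₂ q₁ q₂ r₁ r₂ →
        p₁ :* (q₁ :* r₂ :- q₂ :* r₁) :+ r₁ :* (p₁ :* q₂ :- p₂ :* q₁) := q₁ :* (p₁ :* r₂ :- p₂ :* r₁))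
      refl p₁ p₂ q₁ q₂ r₁ r₂)
    (0≤+ (0≤* (lexPos⇒≥0 p>0) qr) (0≤* (lexPos⇒≥0 r>0) pq)))
  -- A vertical `q` is strictly steeper than a non-vertical `r`, contrary to `qr`.
  det-trans {p₁ , p₂} {q₁ , q₂} {r₁ , r₂} p>0 (inj₂ (q₁≈0 , q₂>0)) (inj₁ r₁>0) pq qr =
    ⊥-elim (pos*pos q₂>0 r₁>0 (0≤-⇒≤0 (≤-respʳ-≈ (begin
      q₁ * r₂ - q₂ * r₁  ≈⟨ +-congʳ (*-congʳ q₁≈0) ⟩
      0# * r₂ - q₂ * r₁  ≈⟨ solve 2 (λ r₂ y → :0 :* r₂ :- y := :- y) refl r₂ (q₂ * r₁) ⟩
      - (q₂ * r₁)        ∎) qr)))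
  det-trans {p₁ , p₂} {q₁ , q₂} {r₁ , r₂} p>0 (inj₂ _) (inj₂ (r₁≈0 , r₂>0)) pq qr =
    ≤-respʳ-≈ (begin
      p₁ * r₂            ≈⟨ solve 2 (λ x p₂ → x := x :- p₂ :* :0) refl (p₁ * r₂) p₂ ⟩
      p₁ * r₂ - p₂ * 0#  ≈⟨ +-congˡ (-‿cong (*-congˡ r₁≈0)) ⟨
      p₁ * r₂ - p₂ * r₁  ∎) (0≤* (lexPos⇒≥0 p>0) (pos⇒≥0 r₂>0))

  -- Parallel vectors and segments

  _∈[0,1]·_ : Point R → Point R → Set
  (p₁ , p₂) ∈[0,1]· (q₁ , q₂) = ∃ λ t → (0# ≤ t) × (t ≤ 1#) × (p₁ ≈ t * q₁) × (p₂ ≈ t * q₂)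

  opaque
    ratio : ∀ {x y} → Positive y → 0# ≤ x → x ≤ y → ∃ λ t → (0# ≤ t) × (t ≤ 1#) × (x ≈ t * y)
    ratio {x} {y} y>0 0≤x x≤y with inverse y (pos⇒≉0 y>0)
    ... | y⁻¹ , yy⁻¹≈1 = x * y⁻¹ , *-cancel-≥0 y>0 (≤-respʳ-≈ x≈yt 0≤x)
        , 0≤-⇒≤ (*-cancel-≥0 y>0 (≤-respʳ-≈ (begin
            y - x                   ≈⟨ +-congˡ (-‿cong x≈yt) ⟩
            y - y * (x * y⁻¹)       ≈⟨ solve 2 (λ y t → y :- y :* t := y :* (:1 :- t)) refl y (x * y⁻¹) ⟩
            y * (1# - x * y⁻¹)      ∎) (≤⇒0≤- x≤y)))
        , trans x≈yt (solve 2 (λ y t → y :* t := t :* y) refl y (x * y⁻¹))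
      where
      x≈yt : x ≈ y * (x * y⁻¹)
      x≈yt = begin
        x               ≈⟨ solve 1 (λ x → x := x :* :1) refl x ⟩
        x * 1#          ≈⟨ *-congˡ yy⁻¹≈1 ⟨
        x * (y * y⁻¹)   ≈⟨ solve 3 (λ x y i → x :* (y :* i) := y :* (x :* i)) refl x y y⁻¹ ⟩
        y * (x * y⁻¹)   ∎

  -- The ratio of the abscissas is the scalar; as q₁ is invertible, the vanishing determinant forces
  -- the same ratio on the ordinates.
  shorter : ∀ {p q} → LexPos p → Positive (proj₁ q) → proj₁ p ≤ proj₁ q → det p q ≈ 0# → p ∈[0,1]· q
  shorter {p₁ , p₂} {q₁ , q₂} p>0 q₁>0 p₁≤q₁ pq≈0 with ratio q₁>0 (lexPos⇒≥0 p>0) p₁≤q₁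
  ... | t , 0≤t , t≤1 , p₁≈tq₁ = t , 0≤t , t≤1 , p₁≈tq₁ , -≈0⇒≈ (*-cancel-0 (pos⇒≉0 q₁>0) (begin
    q₁ * (p₂ - t * q₂)         ≈⟨ solve 4 (λ q₁ p₂ t q₂ → q₁ :* (p₂ :- t :* q₂) := :- ((t :* q₁) :* q₂ :- p₂ :* q₁)) refl q₁ p₂ t q₂ ⟩
    - (t * q₁ * q₂ - p₂ * q₁)  ≈⟨ -‿cong (+-congʳ (*-congʳ p₁≈tq₁)) ⟨
    - (p₁ * q₂ - p₂ * q₁)      ≈⟨ -‿cong pq≈0 ⟩
    - 0#                       ≈⟨ solve 0 (:- :0 := :0) refl ⟩
    0#                         ∎))

  mixed-det : ∀ {p q} → proj₁ p ≈ 0# → Positive (proj₂ p) → Positive (proj₁ q) → ¬ det p q ≈ 0#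
  mixed-det {p₁ , p₂} {q₁ , q₂} p₁≈0 p₂>0 q₁>0 pq≈0 = pos⇒≉0 q₁>0 (*-cancel-0 (pos⇒≉0 p₂>0) (begin
    p₂ * q₁                   ≈⟨ solve 2 (λ x q₂ → x := :0 :* q₂ :- (:0 :* q₂ :- x)) refl (p₂ * q₁) q₂ ⟩
    0# * q₂ - (0# * q₂ - p₂ * q₁) ≈⟨ +-congˡ (-‿cong (+-congʳ (*-congʳ p₁≈0))) ⟨
    0# * q₂ - (p₁ * q₂ - p₂ * q₁) ≈⟨ +-congˡ (-‿cong pq≈0) ⟩
    0# * q₂ - 0#              ≈⟨ solve 1 (λ q₂ → :0 :* q₂ :- :0 := :0) refl q₂ ⟩
    0#                        ∎))

  vertical : ∀ {p q} → proj₁ p ≈ 0# → proj₁ q ≈ 0# → Positive (proj₂ p) → Positive (proj₂ q) →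
    proj₂ p ≤ proj₂ q → p ∈[0,1]· q
  vertical {p₁ , p₂} {q₁ , q₂} p₁≈0 q₁≈0 p₂>0 q₂>0 p₂≤q₂ with ratio q₂>0 (pos⇒≥0 p₂>0) p₂≤q₂
  ... | t , 0≤t , t≤1 , p₂≈tq₂ = t , 0≤t , t≤1 , (begin
      p₁      ≈⟨ p₁≈0 ⟩
      0#      ≈⟨ solve 1 (λ t → :0 := t :* :0) refl t ⟩
      t * 0#  ≈⟨ *-congˡ q₁≈0 ⟨
      t * q₁  ∎) , p₂≈tq₂

  opaque
    -- In a common half plane equal slopes mean a common ray, so the shorter vector ends on the
    -- longer one. For two edges at a common vertex this is what `noHit` forbids.
    parallel : ∀ {p q} → LexPos p → LexPos q → det p q ≈ 0# → p ∈[0,1]· q ⊎ q ∈[0,1]· p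
    parallel {p} {q} p>0@(inj₁ p₁>0) q>0@(inj₁ q₁>0) pq≈0 with total (proj₁ p) (proj₁ q)
    ... | inj₁ p₁≤q₁ = inj₁ (shorter p>0 q₁>0 p₁≤q₁ pq≈0)
    ... | inj₂ q₁≤p₁ = inj₂ (shorter q>0 p₁>0 q₁≤p₁ (det-swap≈0 p q pq≈0))
    parallel (inj₂ (p₁≈0 , p₂>0)) (inj₁ q₁>0) pq≈0 = ⊥-elim (mixed-det p₁≈0 p₂>0 q₁>0 pq≈0)
    parallel {p} {q} (inj₁ p₁>0) (inj₂ (q₁≈0 , q₂>0)) pq≈0 =
      ⊥-elim (mixed-det q₁≈0 q₂>0 p₁>0 (det-swap≈0 p q pq≈0))
    parallel {p₁ , p₂} {q₁ , q₂} (inj₂ (p₁≈0 , p₂>0)) (inj₂ (q₁≈0 , q₂>0)) pq≈0 with total p₂ q₂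
    ... | inj₁ p₂≤q₂ = inj₁ (vertical p₁≈0 q₁≈0 p₂>0 q₂>0 p₂≤q₂)
    ... | inj₂ q₂≤p₂ = inj₂ (vertical q₁≈0 p₁≈0 q₂>0 p₂>0 q₂≤p₂)

  -- Edge vectors at `v` are always taken lexicographically positive: they leave `v` here and enter
  -- it in `onSegment⁻`.
  onSegment⁺ : ∀ v x y → (x -ₚ v) ∈[0,1]· (y -ₚ v) → OnSegment R x v y
  onSegment⁺ (v₁ , v₂) (x₁ , x₂) (y₁ , y₂) (t , 0≤t , t≤1 , eq₁ , eq₂) =
    t , 0≤t , t≤1 , move v₁ x₁ eq₁ , move v₂ x₂ eq₂
    where
    move : ∀ v x {z} → x - v ≈ z → x ≈ v + z
    move v x eq = trans (solve 2 (λ v x → x := v :+ (x :- v)) refl v x) (+-congˡ eq)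

  onSegment⁻ : ∀ v x y → (v -ₚ x) ∈[0,1]· (v -ₚ y) → OnSegment R x v y
  onSegment⁻ (v₁ , v₂) (x₁ , x₂) (y₁ , y₂) (t , 0≤t , t≤1 , eq₁ , eq₂) =
    t , 0≤t , t≤1 , move v₁ x₁ y₁ eq₁ , move v₂ x₂ y₂ eq₂
    where
    move : ∀ v x y → v - x ≈ t * (v - y) → x ≈ v + t * (y - v)
    move v x y eq = begin
      x                  ≈⟨ solve 2 (λ v x → x := v :- (v :- x)) refl v x ⟩
      v - (v - x)        ≈⟨ +-congˡ (-‿cong eq) ⟩
      v - t * (v - y)    ≈⟨ solve 3 (λ v t y → v :- t :* (v :- y) := v :+ t :* (y :- v)) refl v t y ⟩
      v + t * (y - v)    ∎

  onSegment-sym : ∀ x v y → OnSegment R x v y → OnSegment R x y v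
  onSegment-sym (x₁ , x₂) (v₁ , v₂) (y₁ , y₂) (t , 0≤t , t≤1 , eq₁ , eq₂) =
    1# - t , ≤⇒0≤- t≤1
    , 0≤-⇒≤ (≤-respʳ-≈ (solve 1 (λ t → t := :1 :- (:1 :- t)) refl t) 0≤t)
    , trans eq₁ (flip v₁ y₁) , trans eq₂ (flip v₂ y₂)
    where
    flip : ∀ v y → v + t * (y - v) ≈ y + (1# - t) * (v - y)
    flip v y = solve 3 (λ v y t → v :+ t :* (y :- v) := y :+ (:1 :- t) :* (v :- y)) refl v y t

  -- The lower bound

  module LowerBound {a b k : ℕ} (D : Drawing R (K (suc a) b)) (slopes : AtMostSlopes R D k) (a<b : suc a ℕ.≤ b) where
    open Drawing D

    A : Fin (suc a) → Point R
    A i = pos (inj₁ i)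

    B : Fin b → Point R
    B j = pos (inj₂ j)

    colour : Fin (suc a) → Fin b → Fin k
    colour i j = proj₁ slopes (i , j)

    opaque
      -- Reversing both edges leaves the determinant unchanged.
      colour⇒det⁻ : ∀ {i j i′ j′} → colour i j ≡ colour i′ j′ → det (A i -ₚ B j) (A i′ -ₚ B j′) ≈ 0#
      colour⇒det⁻ {i} {j} {i′} {j′} eq with A i | B j | A i′ | B j′ | proj₂ slopes (i , j) (i′ , j′) eq
      ... | p₁ , p₂ | q₁ , q₂ | r₁ , r₂ | s₁ , s₂ | same =
        trans (+-cong (flip p₁ q₁ r₂ s₂) (-‿cong (flip p₂ q₂ r₁ s₁))) (≈⇒-≈0 same)
        where
        flip : ∀ p q r s → (p - q) * (r - s) ≈ (q - p) * (s - r)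
        flip = solve 4 (λ p q r s → (p :- q) :* (r :- s) := (q :- p) :* (s :- r)) refl

    colour⇒det⁺ : ∀ {i j i′ j′} → colour i j ≡ colour i′ j′ → det (B j -ₚ A i) (B j′ -ₚ A i′) ≈ 0#
    colour⇒det⁺ {i} {j} {i′} {j′} eq = ≈⇒-≈0 (proj₂ slopes (i , j) (i′ , j′) eq)

    -- Two edges leaving `A i` to the same side with one slope would overlap, and the longer would
    -- pass through the end of the shorter.
    meet-A⁻ : ∀ i {j j′} → LexPos (A i -ₚ B j) → LexPos (A i -ₚ B j′) → colour i j ≡ colour i j′ → j ≡ j′
    meet-A⁻ i {j} {j′} j<i j′<i eq with j ≟ j′
    ... | yes j≡j′ = j≡j′
    ... | no  j≢j′ with parallel j<i j′<i (colour⇒det⁻ eq)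
    ...   | inj₁ hit = ⊥-elim (noHit (i , j′) (inj₂ j) (λ ()) (λ { ≡.refl → j≢j′ ≡.refl })
                         (onSegment⁻ (A i) (B j) (B j′) hit))
    ...   | inj₂ hit = ⊥-elim (noHit (i , j) (inj₂ j′) (λ ()) (λ { ≡.refl → j≢j′ ≡.refl })
                         (onSegment⁻ (A i) (B j′) (B j) hit))

    meet-A⁺ : ∀ i {j j′} → LexPos (B j -ₚ A i) → LexPos (B j′ -ₚ A i) → colour i j ≡ colour i j′ → j ≡ j′
    meet-A⁺ i {j} {j′} j>i j′>i eq with j ≟ j′
    ... | yes j≡j′ = j≡j′
    ... | no  j≢j′ with parallel j>i j′>i (colour⇒det⁺ eq)
    ...   | inj₁ hit = ⊥-elim (noHit (i , j′) (inj₂ j) (λ ()) (λ { ≡.refl → j≢j′ ≡.refl })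
                         (onSegment⁺ (A i) (B j) (B j′) hit))
    ...   | inj₂ hit = ⊥-elim (noHit (i , j) (inj₂ j′) (λ ()) (λ { ≡.refl → j≢j′ ≡.refl })
                         (onSegment⁺ (A i) (B j′) (B j) hit))

    -- Stated with a determinant instead of colours, since `crossing` obtains the equality of slopes
    -- from two inequalities.
    meet-B : ∀ j {i i′} → LexPos (A i -ₚ B j) → LexPos (A i′ -ₚ B j) → det (A i -ₚ B j) (A i′ -ₚ B j) ≈ 0# → i ≡ i′
    meet-B j {i} {i′} i>j i′>j det≈0 with i ≟ i′
    ... | yes i≡i′ = i≡i′
    ... | no  i≢i′ with parallel i>j i′>j det≈0
    ...   | inj₁ hit = ⊥-elim (noHit (i′ , j) (inj₁ i) (λ { ≡.refl → i≢i′ ≡.refl }) (λ ())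
                         (onSegment-sym (A i) (B j) (A i′) (onSegment⁺ (B j) (A i) (A i′) hit)))
    ...   | inj₂ hit = ⊥-elim (noHit (i , j) (inj₁ i′) (λ { ≡.refl → i≢i′ ≡.refl }) (λ ())
                         (onSegment-sym (A i′) (B j) (A i) (onSegment⁺ (B j) (A i′) (A i) hit)))

    -- The reflexive closure of the strict lexicographic order is what `argmin` accepts.
    leftmost : ∃ λ v → ∀ w → v ≡ w ⊎ LexPos (A w -ₚ A v)
    leftmost with argmin {P = λ _ → ⊤} {λ v w → v ≡ w ⊎ LexPos (A w -ₚ A v)} (λ _ → yes tt) ord-total
                    (λ {u} {v} {w} _ _ _ → ord-trans u v w)
      where
      ord-total : ∀ v w → ⊤ → ⊤ → (v ≡ w ⊎ LexPos (A w -ₚ A v)) ⊎ (w ≡ v ⊎ LexPos (A v -ₚ A w))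
      ord-total v w _ _ with v ≟ w
      ... | yes v≡w = inj₁ (inj₁ v≡w)
      ... | no  v≢w with lex-total (A v) (A w) (distinct _ _ λ { ≡.refl → v≢w ≡.refl })
      ...   | inj₁ v<w = inj₁ (inj₂ v<w)
      ...   | inj₂ w<v = inj₂ (inj₂ w<v)
      ord-trans : ∀ u v w → u ≡ v ⊎ LexPos (A v -ₚ A u) → v ≡ w ⊎ LexPos (A w -ₚ A v) → u ≡ w ⊎ LexPos (A w -ₚ A u)
      ord-trans u v w (inj₁ ≡.refl) v≤w = v≤w
      ord-trans u v w (inj₂ u<v) (inj₁ ≡.refl) = inj₂ u<v
      ord-trans u v w (inj₂ u<v) (inj₂ v<w) = inj₂ (lex-trans (A u) (A v) (A w) u<v v<w)
    ... | inj₁ (v , _ , min) = v , λ w → min w tt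
    ... | inj₂ none          = ⊥-elim (none zero tt)

    o : Fin (suc a)
    o = proj₁ leftmost

    Left : Fin b → Set
    Left y = LexPos (A o -ₚ B y)

    left? : ∀ y → Dec (Left y)
    left? y = lexPos? (A o -ₚ B y)

    right : ∀ {y} → ¬ Left y → LexPos (B y -ₚ A o)
    right {y} ¬left with lex-total (A o) (B y) (distinct _ _ λ ())
    ... | inj₁ y>o  = y>o
    ... | inj₂ left = ⊥-elim (¬left left)

    left-of-all : ∀ {y} → Left y → ∀ w → LexPos (A w -ₚ B y)
    left-of-all {y} left w with proj₂ leftmost w
    ... | inj₁ ≡.refl = left
    ... | inj₂ w>o    = lex-trans (B y) (A o) (A w) left w>o

    -- `Left x` is assumed only inside the pair, so that the vertex depends on `x` alone and
    -- `saddle` can compare these vertices.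
    steepest : ∀ x → ∃ λ v → Left x → ∀ w → 0# ≤ det (A w -ₚ B x) (A v -ₚ B x)
    steepest x with left? x
    -- `o` is an arbitrary default here.
    ... | no ¬left = o , λ left → ⊥-elim (¬left left)
    -- The comparison is reversed, so the minimum has the largest slope.
    ... | yes left with argmin {P = λ _ → ⊤} {λ v w → 0# ≤ det (A w -ₚ B x) (A v -ₚ B x)} (λ _ → yes tt)
                          (λ v w _ _ → det-total (A w -ₚ B x) (A v -ₚ B x))
                          (λ {u} {v} {w} _ _ _ uv vw → det-trans (left-of-all left w) (left-of-all left v) (left-of-all left u) vw uv)
    ...   | inj₁ (v , _ , max) = v , λ _ w → max w tt
    ...   | inj₂ none          = ⊥-elim (none zero tt)

    -- x minimises the maximal slope of the edges at x.
    saddle : (∃ λ v → ∃ λ x → Left x × (∀ w → 0# ≤ det (A w -ₚ B x) (A v -ₚ B x)) ×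
                      (∀ y → Left y → 0# ≤ det (A v -ₚ B x) (A v -ₚ B y))) ⊎ (∀ y → ¬ Left y)
    saddle with argmin {P = Left} {λ x y → 0# ≤ det (top x) (top y)} left? (λ x y _ _ → det-total (top x) (top y))
                  (λ {x} {y} {z} lx ly lz → det-trans {top x} {top y} {top z}
                    (left-of-all lx _) (left-of-all ly _) (left-of-all lz _))
      where
      top : Fin b → Point R
      top x = A (proj₁ (steepest x)) -ₚ B x
    ... | inj₂ none = inj₂ none
    ... | inj₁ (x , left , min) = inj₁ (v , x , left , max , λ y left-y →
            -- Let w be the steepest vertex for `y`. The slope of vx is at most that of wy by the
            -- choice of `x`, and that of wx at most that of vx by the choice of `v`; the two
            -- determinants add up to the required one.
            ≤-respʳ-≈ (exchange (A v) (A (proj₁ (steepest y))) (B x) (B y))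
              (0≤+ (min y left-y) (max (proj₁ (steepest y)))))
      where
      v : Fin (suc a)
      v = proj₁ (steepest x)
      max : ∀ w → 0# ≤ det (A w -ₚ B x) (A v -ₚ B x)
      max = proj₂ (steepest x) left
      -- Since (v - x) + (w - y) = (w - x) + (v - y).
      exchange : ∀ v w x y → det (v -ₚ x) (w -ₚ y) + det (w -ₚ x) (v -ₚ x) ≈ det (v -ₚ x) (v -ₚ y)
      exchange (v₁ , v₂) (w₁ , w₂) (x₁ , x₂) (y₁ , y₂) = trans
        (solve 6 (λ s₁ s₂ α₁ α₂ β₁ β₂ → s₁ :* α₂ :- s₂ :* α₁ :+ (β₁ :* s₂ :- β₂ :* s₁)
            := s₁ :* (s₂ :+ α₂ :- β₂) :- s₂ :* (s₁ :+ α₁ :- β₁)) refl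
          (v₁ - x₁) (v₂ - x₂) (w₁ - y₁) (w₂ - y₂) (w₁ - x₁) (w₂ - x₂))
        (+-cong (*-congˡ (cancel v₂ x₂ w₂ y₂)) (-‿cong (*-congˡ (cancel v₁ x₁ w₁ y₁))))
        where
        cancel : ∀ v x w y → (v - x) + (w - y) - (w - x) ≈ v - y
        cancel = solve 4 (λ v x w y → (v :- x) :+ (w :- y) :- (w :- x) := v :- y) refl

    -- An injection into two copies of the colours: one copy for the edges at the saddle point, one
    -- for the edges from `o` to the right. The summand `a` counts A without `v`, because the edge
    -- vx already occurs among the edges from `v` to the left part.
    bound : a ℕ.+ b ℕ.≤ k ℕ.+ k
    bound with saddle
    -- With nothing to the left, the b edges at `o` need b colours, and a is at most b.
    ... | inj₂ none = ℕ.+-mono-≤ (ℕ.≤-trans (ℕ.≤-trans (ℕ.n≤1+n a) a<b) b≤k) b≤k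
      where
      b≤k : b ℕ.≤ k
      b≤k = injective⇒≤ {f = colour o} (meet-A⁺ o (right (none _)) (right (none _)))
    ... | inj₁ (v , x , left-x , max , min) = injective⇒≤ {f = join k k ∘ g ∘ splitAt a}
            λ {i} {j} eq → ≡.trans (≡.sym (join-splitAt a b i)) (≡.trans
              (≡.cong (join a b) (g-injective (splitAt a i) (splitAt a j)
                (≡.trans (≡.sym (splitAt-join k k _)) (≡.trans (≡.cong (splitAt k) eq) (splitAt-join k k _)))))
              (join-splitAt a b j))
      where
      -- The decision is an argument so that injectivity can be proved by matching on it.
      gᴮ : ∀ y → Dec (Left y) → Fin k ⊎ Fin k
      gᴮ y (yes _) = inj₁ (colour v y)
      gᴮ y (no _)  = inj₂ (colour o y)

      g : Fin a ⊎ Fin b → Fin k ⊎ Fin k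
      g (inj₁ w) = inj₁ (colour (punchIn v w) x)
      g (inj₂ y) = gᴮ y (left? y)

      -- Otherwise slope(wx) = slope(vy) ≥ slope(vx) ≥ slope(wx), so wx and vx are parallel edges at
      -- `x` and w = v, which `punchIn` avoids.
      crossing : ∀ {w y} → Left y → colour (punchIn v w) x ≢ colour v y
      crossing {w} {y} left-y eq = punchInᵢ≢i v w (meet-B x (left-of-all left-x _) (left-of-all left-x _)
        (antisym
          (0≤-⇒≤0 (≤-respʳ-≈ (det-antisym (A w′ -ₚ B x) (A v -ₚ B x))
            (det-trans (left-of-all left-x v) (left-of-all left-y v) (left-of-all left-x w′) (min y left-y)
              (≤-reflexive (sym (det-swap≈0 _ _ (colour⇒det⁻ eq)))))))
          (max w′)))
        where
        w′ : Fin (suc a)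
        w′ = punchIn v w

      gᴮ-injective : ∀ y y′ (l : Dec (Left y)) (l′ : Dec (Left y′)) → gᴮ y l ≡ gᴮ y′ l′ → y ≡ y′
      gᴮ-injective y y′ (yes l) (yes l′) eq = meet-A⁻ v (left-of-all l v) (left-of-all l′ v) (inj₁-injective eq)
      gᴮ-injective y y′ (no r)  (no r′)  eq = meet-A⁺ o (right r) (right r′) (inj₂-injective eq)

      cross-injective : ∀ w y (l : Dec (Left y)) → g (inj₁ w) ≢ gᴮ y l
      cross-injective w y (yes l) eq = crossing l (inj₁-injective eq)

      g-injective : ∀ s t → g s ≡ g t → s ≡ t
      g-injective (inj₁ w) (inj₁ w′) eq = ≡.cong inj₁ (punchIn-injective v w w′
        (meet-B x (left-of-all left-x _) (left-of-all left-x _) (colour⇒det⁻ (inj₁-injective eq))))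
      g-injective (inj₁ w) (inj₂ y)  eq = ⊥-elim (cross-injective w y (left? y) eq)
      g-injective (inj₂ y) (inj₁ w)  eq = ⊥-elim (cross-injective w y (left? y) (≡.sym eq))
      g-injective (inj₂ y) (inj₂ y′) eq = ≡.cong inj₂ (gᴮ-injective y y′ (left? y) (left? y′) eq)

  fromℕ-injective : ∀ m n → fromℕ m ≈ fromℕ n → m ≡ n
  fromℕ-injective zero    zero    _  = ≡.refl
  fromℕ-injective zero    (suc n) eq = ⊥-elim (pos⇒≉0 (fromℕ-suc-pos n) (sym eq))
  fromℕ-injective (suc m) zero    eq = ⊥-elim (pos⇒≉0 (fromℕ-suc-pos m) eq)
  fromℕ-injective (suc m) (suc n) eq = ≡.cong suc (fromℕ-injective m n (begin
    fromℕ m               ≈⟨ solve 1 (λ x → x := (:1 :+ x) :- :1) refl (fromℕ m) ⟩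
    1# + fromℕ m - 1#     ≈⟨ +-congʳ (trans (sym (fromℕ-suc m)) (trans eq (fromℕ-suc n))) ⟩
    1# + fromℕ n - 1#     ≈⟨ solve 1 (λ x → (:1 :+ x) :- :1 := x) refl (fromℕ n) ⟩
    fromℕ n               ∎))

  neg-injective : ∀ {x y} → - x ≈ - y → x ≈ y
  neg-injective {x} {y} eq = begin
    x      ≈⟨ solve 1 (λ x → x := :- :- x) refl x ⟩
    - - x  ≈⟨ -‿cong eq ⟩
    - - y  ≈⟨ solve 1 (λ x → :- :- x := x) refl y ⟩
    y      ∎

  -- Building drawings of complete bipartite graphs

  _≈ₚ_ : Point R → Point R → Set
  p ≈ₚ q = (proj₁ p ≈ proj₁ q) × (proj₂ p ≈ proj₂ q)

  Between : Carrier → Point R → Point R → Point R → Set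
  Between t w p q = (proj₁ w ≈ proj₁ p + t * (proj₁ q - proj₁ p)) × (proj₂ w ≈ proj₂ p + t * (proj₂ q - proj₂ p))

  between-0 : ∀ {t w p q} → t ≈ 0# → Between t w p q → w ≈ₚ p
  between-0 {t} t≈0 (eq₁ , eq₂) = trans eq₁ (at-0 _ _) , trans eq₂ (at-0 _ _)
    where
    at-0 : ∀ p q → p + t * (q - p) ≈ p
    at-0 p q = trans (+-congˡ (*-congʳ t≈0)) (solve 2 (λ p q → p :+ :0 :* (q :- p) := p) refl p q)

  between-1 : ∀ {t w p q} → t ≈ 1# → Between t w p q → w ≈ₚ q
  between-1 {t} t≈1 (eq₁ , eq₂) = trans eq₁ (at-1 _ _) , trans eq₂ (at-1 _ _)
    where
    at-1 : ∀ p q → p + t * (q - p) ≈ q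
    at-1 p q = trans (+-congˡ (*-congʳ t≈1)) (solve 2 (λ p q → p :+ :1 :* (q :- p) := q) refl p q)

  -- A vertex found at parameter 0 or 1 of an edge coincides with an endpoint, and injectivity of
  -- `pos` then identifies the two.
  drawing : ∀ {a b} (pos : Fin a ⊎ Fin b → Point R) →
    (∀ v w → pos v ≈ₚ pos w → v ≡ w) →
    (∀ i j w t → 0# ≤ t → Between t (pos w) (pos (inj₁ i)) (pos (inj₂ j)) → t ≈ 0# ⊎ t ≈ 1#) →
    Drawing R (K a b)
  drawing pos injective ends-only = record
    { pos      = pos
    ; distinct = λ v w v≢w eq → v≢w (injective v w eq)
    ; noHit    = λ { (i , j) w w≢i w≢j (t , 0≤t , _ , on) → off i j w w≢i w≢j on (ends-only i j w t 0≤t on) }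
    }
    where
    off : ∀ i j w {t} → w ≢ inj₁ i → w ≢ inj₂ j → Between t (pos w) (pos (inj₁ i)) (pos (inj₂ j)) → ¬ (t ≈ 0# ⊎ t ≈ 1#)
    off i j w w≢i w≢j on (inj₁ t≈0) = w≢i (injective _ _ (between-0 t≈0 on))
    off i j w w≢i w≢j on (inj₂ t≈1) = w≢j (injective _ _ (between-1 t≈1 on))

  -- Deleting vertices from a drawing creates neither incidences nor slopes.
  restrict : ∀ {a a′ b b′ k} (f : Fin a → Fin a′) (g : Fin b → Fin b′) →
    Injective _≡_ _≡_ f → Injective _≡_ _≡_ g →
    SlopeNumber≤ R (K a′ b′) k → SlopeNumber≤ R (K a b) k
  restrict f g f-inj g-inj (D , colour , parallel) = record
    { pos      = pos ∘ Sum.map f g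
    ; distinct = λ v w v≢w → distinct _ _ (v≢w ∘ map-injective v w)
    ; noHit    = λ { (i , j) w w≢i w≢j → noHit (f i , g j) (Sum.map f g w)
                       (w≢i ∘ map-injective w (inj₁ i)) (w≢j ∘ map-injective w (inj₂ j)) }
    } , (λ { (i , j) → colour (f i , g j) }) , λ { (i , j) (i′ , j′) → parallel (f i , g j) (f i′ , g j′) }
    where
    open Drawing D
    map-injective : ∀ v w → Sum.map f g v ≡ Sum.map f g w → v ≡ w
    map-injective (inj₁ i) (inj₁ i′) eq = ≡.cong inj₁ (f-inj (inj₁-injective eq))
    map-injective (inj₂ j) (inj₂ j′) eq = ≡.cong inj₂ (g-inj (inj₂-injective eq))

  -- One part on a line, the other one on two parallel lines

  module Strip (a m : ℕ) where

    -- The offset by `a` on the lower line makes its edges repeat the slopes of the upper one.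
    far : Fin m ⊎ Fin m → Point R
    far (inj₁ j) = fromℕ (toℕ j) , 1#
    far (inj₂ j) = - fromℕ (a ℕ.+ toℕ j) , - 1#

    pos : Fin (suc a) ⊎ Fin (m ℕ.+ m) → Point R
    pos (inj₁ i) = - fromℕ (toℕ i) , 0#
    pos (inj₂ j) = far (splitAt m j)

    -1≉0 : ¬ - 1# ≈ 0#
    -1≉0 eq = 0≉1 (neg-injective (trans (solve 0 (:- :0 := :0) refl) (sym eq)))

    1≉-1 : ¬ 1# ≈ - 1#
    1≉-1 eq = pos+nonneg 1-pos 0≤1 (≤-reflexive (trans (+-congʳ eq) (solve 0 (:- :1 :+ :1 := :0) refl)))

    far-off : ∀ s {x} → ¬ far s ≈ₚ (x , 0#)
    far-off (inj₁ j) (_ , eq) = 0≉1 (sym eq)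
    far-off (inj₂ j) (_ , eq) = -1≉0 eq

    far-injective : ∀ s s′ → far s ≈ₚ far s′ → s ≡ s′
    far-injective (inj₁ j) (inj₁ j′) (eq , _) = ≡.cong inj₁ (toℕ-injective (fromℕ-injective _ _ eq))
    far-injective (inj₁ j) (inj₂ j′) (_ , eq) = ⊥-elim (1≉-1 eq)
    far-injective (inj₂ j) (inj₁ j′) (_ , eq) = ⊥-elim (1≉-1 (sym eq))
    far-injective (inj₂ j) (inj₂ j′) (eq , _) = ≡.cong inj₂ (toℕ-injective
      (ℕ.+-cancelˡ-≡ a _ _ (fromℕ-injective _ _ (neg-injective eq))))

    pos-injective : ∀ v w → pos v ≈ₚ pos w → v ≡ w
    pos-injective (inj₁ i) (inj₁ i′) (eq , _) =
      ≡.cong inj₁ (toℕ-injective (fromℕ-injective _ _ (neg-injective eq)))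
    pos-injective (inj₁ i) (inj₂ j) (eq₁ , eq₂) = ⊥-elim (far-off (splitAt m j) (sym eq₁ , sym eq₂))
    pos-injective (inj₂ j) (inj₁ i) eq = ⊥-elim (far-off (splitAt m j) eq)
    pos-injective (inj₂ j) (inj₂ j′) eq = ≡.cong inj₂ (≡.trans (≡.sym (join-splitAt m m j))
      (≡.trans (≡.cong (join m m) (far-injective (splitAt m j) (splitAt m j′) eq)) (join-splitAt m m j′)))

    height⁺ : ∀ {y t} → y ≈ 0# + t * (1# - 0#) → t ≈ y
    height⁺ {y} {t} eq = trans (solve 1 (λ t → t := :0 :+ t :* (:1 :- :0)) refl t) (sym eq)

    height⁻ : ∀ {y t} → y ≈ 0# + t * (- 1# - 0#) → t ≈ - y
    height⁻ {y} {t} eq = trans (solve 1 (λ t → t := :- (:0 :+ t :* (:- :1 :- :0))) refl t) (-‿cong (sym eq))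

    -- At parameter t the edge has height t or -t, so t can be read off from the height of the
    -- vertex. A vertex on the opposite line would give t = -1.
    ends-only-far : ∀ s s′ {t} → 0# ≤ t → proj₂ (far s′) ≈ 0# + t * (proj₂ (far s) - 0#) → t ≈ 1#
    ends-only-far (inj₁ _) (inj₁ _) 0≤t eq = height⁺ eq
    ends-only-far (inj₁ _) (inj₂ _) 0≤t eq =
      ⊥-elim (1-pos (0≤-⇒≤0 (≤-respʳ-≈ (height⁺ eq) 0≤t)))
    ends-only-far (inj₂ _) (inj₁ _) 0≤t eq =
      ⊥-elim (1-pos (0≤-⇒≤0 (≤-respʳ-≈ (height⁻ eq) 0≤t)))
    ends-only-far (inj₂ _) (inj₂ _) 0≤t eq = trans (height⁻ eq) (solve 0 (:- :- :1 := :1) refl)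

    ends-only-near : ∀ s {t} → 0# ≈ 0# + t * (proj₂ (far s) - 0#) → t ≈ 0#
    ends-only-near (inj₁ _) eq = height⁺ eq
    ends-only-near (inj₂ _) eq = trans (height⁻ eq) (solve 0 (:- :0 := :0) refl)

    ends-only : ∀ i j w t → 0# ≤ t → Between t (pos w) (pos (inj₁ i)) (pos (inj₂ j)) → t ≈ 0# ⊎ t ≈ 1#
    ends-only i j (inj₁ i′) t 0≤t (_ , eq) = inj₁ (ends-only-near (splitAt m j) eq)
    ends-only i j (inj₂ j′) t 0≤t (_ , eq) = inj₂ (ends-only-far (splitAt m j) (splitAt m j′) 0≤t eq)

    -- Horizontal over vertical displacement of the edge. On the lower line it is a + j - i, and
    -- `opposite i` stands for a - i.
    cotangent : Fin (suc a) → Fin m ⊎ Fin m → ℕ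
    cotangent i (inj₁ j) = toℕ j ℕ.+ toℕ i
    cotangent i (inj₂ j) = toℕ j ℕ.+ toℕ (opposite i)

    -- The values run from 0 to (m - 1) + a, hence m + a slopes.
    cotangent< : ∀ i s → cotangent i s ℕ.< m ℕ.+ a
    cotangent< i (inj₁ j) = ℕ.+-mono-<-≤ (toℕ<n j) (toℕ≤pred[n] i)
    cotangent< i (inj₂ j) = ℕ.+-mono-<-≤ (toℕ<n j) (toℕ≤pred[n] (opposite i))

    direction : ∀ i s → proj₁ (far s) - - fromℕ (toℕ i) ≈ (proj₂ (far s) - 0#) * fromℕ (cotangent i s)
    direction i (inj₁ j) = begin
      fromℕ (toℕ j) - - fromℕ (toℕ i)             ≈⟨ solve 2 (λ x y → x :- :- y := (:1 :- :0) :* (x :+ y)) refl _ _ ⟩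
      (1# - 0#) * (fromℕ (toℕ j) + fromℕ (toℕ i)) ≈⟨ *-congˡ (fromℕ-+ (toℕ j) (toℕ i)) ⟨
      (1# - 0#) * fromℕ (toℕ j ℕ.+ toℕ i)         ∎
    direction i (inj₂ j) = begin
      - fromℕ (a ℕ.+ toℕ j) - - fromℕ (toℕ i)
        ≈⟨ +-congʳ (-‿cong (trans (reflexive (≡.cong fromℕ split)) (trans (fromℕ-+ (toℕ j ℕ.+ toℕ (opposite i)) (toℕ i)) (+-congʳ (fromℕ-+ (toℕ j) (toℕ (opposite i))))))) ⟩
      - (fromℕ (toℕ j) + fromℕ (toℕ (opposite i)) + fromℕ (toℕ i)) - - fromℕ (toℕ i)
        ≈⟨ solve 3 (λ x y z → :- (x :+ y :+ z) :- :- z := (:- :1 :- :0) :* (x :+ y)) refl _ _ _ ⟩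
      (- 1# - 0#) * (fromℕ (toℕ j) + fromℕ (toℕ (opposite i)))
        ≈⟨ *-congˡ (fromℕ-+ (toℕ j) (toℕ (opposite i))) ⟨
      (- 1# - 0#) * fromℕ (toℕ j ℕ.+ toℕ (opposite i)) ∎
      where
      split : a ℕ.+ toℕ j ≡ toℕ j ℕ.+ toℕ (opposite i) ℕ.+ toℕ i
      split = ≡.trans (ℕ.+-comm a (toℕ j)) (≡.trans
        (≡.cong (toℕ j ℕ.+_) (≡.trans (≡.sym (ℕ.m∸n+n≡m (toℕ≤pred[n] i))) (≡.cong (ℕ._+ toℕ i) (≡.sym (opposite-prop i)))))
        (≡.sym (ℕ.+-assoc (toℕ j) _ _)))

    slopeNumber≤ : SlopeNumber≤ R (K (suc a) (m ℕ.+ m)) (m ℕ.+ a)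
    slopeNumber≤ = drawing pos pos-injective ends-only
      , (λ { (i , j) → fromℕ< (cotangent< i (splitAt m j)) })
      , λ { (i , j) (i′ , j′) eq → same i (splitAt m j) i′ (splitAt m j′)
              (≡.trans (≡.sym (toℕ-fromℕ< _)) (≡.trans (≡.cong toℕ eq) (toℕ-fromℕ< _))) }
      where
      same : ∀ i s i′ s′ → cotangent i s ≡ cotangent i′ s′ →
        SameSlope R (pos (inj₁ i)) (far s) (pos (inj₁ i′)) (far s′)
      same i s i′ s′ eq = begin
        (proj₁ (far s) - - fromℕ (toℕ i)) * h′         ≈⟨ *-congʳ (direction i s) ⟩
        h * fromℕ (cotangent i s) * h′                 ≡⟨ ≡.cong (λ c → h * fromℕ c * h′) eq ⟩
        h * fromℕ (cotangent i′ s′) * h′               ≈⟨ solve 3 (λ h c h′ → h :* c :* h′ := h :* (h′ :* c)) refl h _ h′ ⟩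
        h * (h′ * fromℕ (cotangent i′ s′))             ≈⟨ *-congˡ (direction i′ s′) ⟨
        h * (proj₁ (far s′) - - fromℕ (toℕ i′))        ∎
        where
        h h′ : Carrier
        h  = proj₂ (far s) - 0#
        h′ = proj₂ (far s′) - 0#

  -- Bounds on absolute values

  -- This is |x| ≤ M, written so that bounds follow from polynomial identities between nonnegative
  -- terms.
  Within : Carrier → Carrier → Set
  Within M x = (0# ≤ M - x) × (0# ≤ M + x)

  2-pos : Positive (1# + 1#)
  2-pos = pos+nonneg 1-pos 0≤1

  halve : ∀ {x y} → 0# ≤ y → y ≈ (1# + 1#) * x → 0# ≤ x
  halve 0≤y eq = *-cancel-≥0 2-pos (≤-respʳ-≈ eq 0≤y)

  within-≥0 : ∀ {M x} → Within M x → 0# ≤ M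
  within-≥0 {M} {x} (lo , hi) = halve (0≤+ lo hi)
    (solve 2 (λ M x → (M :- x) :+ (M :+ x) := (:1 :+ :1) :* M) refl M x)

  within-+ : ∀ {M N x y} → Within M x → Within N y → Within (M + N) (x + y)
  within-+ {M} {N} {x} {y} (lo , hi) (lo′ , hi′) =
    ≤-respʳ-≈ (solve 4 (λ M N x y → (M :- x) :+ (N :- y) := (M :+ N) :- (x :+ y)) refl M N x y) (0≤+ lo lo′) ,
    ≤-respʳ-≈ (solve 4 (λ M N x y → (M :+ x) :+ (N :+ y) := (M :+ N) :+ (x :+ y)) refl M N x y) (0≤+ hi hi′)

  within-neg : ∀ {M x} → Within M x → Within M (- x)
  within-neg {M} {x} (lo , hi) = ≤-respʳ-≈ (solve 2 (λ M x → M :+ x := M :- :- x) refl M x) hi , lo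

  -- Twice MN - xy, and twice MN + xy, is a sum of two products of the given nonnegative factors.
  within-* : ∀ {M N x y} → Within M x → Within N y → Within (M * N) (x * y)
  within-* {M} {N} {x} {y} (lo , hi) (lo′ , hi′) =
    halve (0≤+ (0≤* lo hi′) (0≤* hi lo′))
      (solve 4 (λ M N x y → (M :- x) :* (N :+ y) :+ (M :+ x) :* (N :- y) := (:1 :+ :1) :* (M :* N :- x :* y)) refl M N x y) ,
    halve (0≤+ (0≤* lo lo′) (0≤* hi hi′))
      (solve 4 (λ M N x y → (M :- x) :* (N :- y) :+ (M :+ x) :* (N :+ y) := (:1 :+ :1) :* (M :* N :+ x :* y)) refl M N x y)

  within-self : ∀ {x} → 0# ≤ x → Within x x
  within-self {x} 0≤x = ≤-reflexive (solve 1 (λ x → :0 := x :- x) refl x) , 0≤+ 0≤x 0≤x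

  within-abs : ∀ x → ∃ λ M → Within M x
  within-abs x with total 0# x
  ... | inj₁ 0≤x = x , within-self 0≤x
  ... | inj₂ x≤0 = - x , 0≤+ (≤0⇒0≤- x≤0) (≤0⇒0≤- x≤0) , ≤-reflexive (solve 1 (λ x → :0 := :- x :+ x) refl x)

  within-weaken : ∀ {M N x} → M ≤ N → Within M x → Within N x
  within-weaken {M} {N} {x} M≤N (lo , hi) =
    ≤-respʳ-≈ (solve 3 (λ M N x → (N :- M) :+ (M :- x) := N :- x) refl M N x) (0≤+ (≤⇒0≤- M≤N) lo) ,
    ≤-respʳ-≈ (solve 3 (λ M N x → (N :- M) :+ (M :+ x) := N :+ x) refl M N x) (0≤+ (≤⇒0≤- M≤N) hi)

  opaque
    -- The witness is c / (c + M + 1).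
    stays-positive : ∀ {c M} → Positive c → 0# ≤ M → ∃ λ ε → Positive ε × (ε ≤ 1#) ×
      (∀ h g → Within ε h → Within M g → Positive (c + h * g))
    stays-positive {c} {M} c>0 0≤M = c * d⁻¹
      , ε>0
      , 0≤-⇒≤ (*-cancel-≥0 d>0 (≤-respʳ-≈ (begin
          M + 1#                      ≈⟨ solve 2 (λ c M → M :+ :1 := (c :+ (M :+ :1)) :- c) refl c M ⟩
          d - c                       ≈⟨ +-congˡ (-‿cong (sym c≈εd)) ⟩
          d - ε * d                   ≈⟨ solve 2 (λ ε d → d :- ε :* d := d :* (:1 :- ε)) refl ε d ⟩
          d * (1# - ε)                ∎) (0≤+ 0≤M 0≤1)))
      -- As c = ε (c + M + 1), the value c + hg splits into ε (c + 1) > 0 and εM + hg ≥ 0.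
      , λ h g wh wg → pos-resp (begin
          ε * (c + 1#) + (ε * M + h * g)    ≈⟨ solve 4 (λ ε c M x → ε :* (c :+ :1) :+ (ε :* M :+ x) := ε :* (c :+ (M :+ :1)) :+ x) refl ε c M (h * g) ⟩
          ε * d + h * g                     ≈⟨ +-congʳ c≈εd ⟩
          c + h * g                         ∎)
          (pos+nonneg (pos*pos ε>0 (pos+nonneg c>0 0≤1)) (proj₂ (within-* wh wg)))
      where
      d : Carrier
      d = c + (M + 1#)
      d>0 : Positive d
      d>0 = pos+nonneg c>0 (0≤+ 0≤M 0≤1)
      d⁻¹ : Carrier
      d⁻¹ = proj₁ (inverse d (pos⇒≉0 d>0))
      ε : Carrier
      ε = c * d⁻¹
      c≈εd : ε * d ≈ c
      c≈εd = begin
        c * d⁻¹ * d    ≈⟨ solve 3 (λ c i d → c :* i :* d := c :* (d :* i)) refl c d⁻¹ d ⟩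
        c * (d * d⁻¹)  ≈⟨ *-congˡ (proj₂ (inverse d (pos⇒≉0 d>0))) ⟩
        c * 1#         ≈⟨ solve 1 (λ c → c :* :1 := c) refl c ⟩
        c              ∎
      ε>0 : Positive ε
      ε>0 ε≤0 = c>0 (≤-respˡ-≈ c≈εd (0≤-⇒≤0 (≤-respʳ-≈
          (solve 2 (λ ε d → :- ε :* d := :- (ε :* d)) refl ε d) (0≤* (≤0⇒0≤- ε≤0) (pos⇒≥0 d>0)))))

  -- The recurrence for sines and its continuity in the parameter

  -- For t = 2 cos θ this is sin (k θ) / sin θ.
  sine : Carrier → ℕ → Carrier
  sine t zero          = 0#
  sine t (suc zero)    = 1#
  sine t (suc (suc k)) = t * sine t (suc k) - sine t k

  sine-cong : ∀ {t t′} → t ≈ t′ → ∀ k → sine t k ≈ sine t′ k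
  sine-cong t≈t′ zero          = refl
  sine-cong t≈t′ (suc zero)    = refl
  sine-cong t≈t′ (suc (suc k)) = +-cong (*-cong t≈t′ (sine-cong t≈t′ (suc k))) (-‿cong (sine-cong t≈t′ k))

  -- Each difference is (t - 2) times a positive term plus the previous difference. So from t = 2 on
  -- the sequence has no zero after the first term.
  sine-increasing : ∀ {t} → 1# + 1# ≤ t → ∀ k → Positive (sine t (suc k)) × (0# ≤ sine t (suc k) - sine t k)
  sine-increasing {t} 2≤t zero = 1-pos , ≤-respʳ-≈ (solve 0 (:1 := :1 :- :0) refl) 0≤1
  sine-increasing {t} 2≤t (suc k) with sine-increasing 2≤t k
  ... | >0 , ≥0 = pos-resp (solve 2 (λ x y → x :+ (y :- x) := y) refl (sine t (suc k)) (sine t (suc (suc k))))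
                    (pos+nonneg >0 step) , step
    where
    step : 0# ≤ sine t (suc (suc k)) - sine t (suc k)
    step = ≤-respʳ-≈ (solve 3 (λ t x y → (t :- (:1 :+ :1)) :* x :+ (x :- y) := t :* x :- y :- x) refl t (sine t (suc k)) (sine t k))
             (0≤+ (0≤* (≤⇒0≤- 2≤t) (pos⇒≥0 >0)) ≥0)

  -- Continuity at `s` without division: `g` is the difference quotient, bounded uniformly for |h| ≤
  -- 1.
  Lipschitz : Carrier → ℕ → Set
  Lipschitz s k = ∃ λ M → (0# ≤ M) × (∀ h → Within 1# h → ∃ λ g → Within M g × (sine (s + h) k ≈ sine s k + h * g))

  within-0 : Within 0# 0#
  within-0 = ≤-reflexive (solve 0 (:0 := :0 :- :0) refl) , ≤-reflexive (solve 0 (:0 := :0 :+ :0) refl)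

  constant-step : ∀ c h → c ≈ c + h * 0#
  constant-step = solve 2 (λ c h → c := c :+ h :* :0) refl

  expand : ∀ s h c₁ c₀ g₁ g₀ →
    (s + h) * (c₁ + h * g₁) - (c₀ + h * g₀) ≈ (s * c₁ - c₀) + h * (c₁ + (s + h) * g₁ - g₀)
  expand = solve 6 (λ s h c₁ c₀ g₁ g₀ → (s :+ h) :* (c₁ :+ h :* g₁) :- (c₀ :+ h :* g₀)
    := (s :* c₁ :- c₀) :+ h :* (c₁ :+ (s :+ h) :* g₁ :- g₀)) refl

  lipschitz-step : ∀ s k → Lipschitz s k → Lipschitz s (suc k) → Lipschitz s (suc (suc k))
  lipschitz-step s k (M₀ , 0≤M₀ , q₀) (M₁ , 0≤M₁ , q₁) = M , 0≤+ (0≤+ (within-≥0 (proj₂ (within-abs (sine s (suc k))))) (0≤* (0≤+ (within-≥0 (proj₂ (within-abs s))) 0≤1) 0≤M₁)) 0≤M₀ , λ h w → quotient h w (q₀ h w) (q₁ h w)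
    where
    S C M : Carrier
    S = proj₁ (within-abs s)
    C = proj₁ (within-abs (sine s (suc k)))
    -- Bounds the new quotient from `expand` term by term, with |s + h| ≤ S + 1.
    M = C + (S + 1#) * M₁ + M₀
    quotient : ∀ h → Within 1# h →
      (∃ λ g → Within M₀ g × (sine (s + h) k ≈ sine s k + h * g)) →
      (∃ λ g → Within M₁ g × (sine (s + h) (suc k) ≈ sine s (suc k) + h * g)) →
      ∃ λ g → Within M g × (sine (s + h) (suc (suc k)) ≈ sine s (suc (suc k)) + h * g)
    quotient h w (g₀ , w₀ , eq₀) (g₁ , w₁ , eq₁) = sine s (suc k) + (s + h) * g₁ - g₀
      , within-+ (within-+ (proj₂ (within-abs (sine s (suc k)))) (within-* (within-+ (proj₂ (within-abs s)) w) w₁)) (within-neg w₀)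
      , trans (+-cong (*-congˡ eq₁) (-‿cong eq₀)) (expand s h (sine s (suc k)) (sine s k) g₁ g₀)

  opaque
    lipschitz : ∀ s k → Lipschitz s k
    lipschitz s zero          = 0# , ≤-refl , λ h _ → 0# , within-0 , constant-step 0# h
    lipschitz s (suc zero)    = 0# , ≤-refl , λ h _ → 0# , within-0 , constant-step 1# h
    lipschitz s (suc (suc k)) = lipschitz-step s k (lipschitz s k) (lipschitz s (suc k))

  opaque
    sine-stays-positive : ∀ s k → Positive (sine s k) →
      ∃ λ ε → Positive ε × (ε ≤ 1#) × (∀ h → Within ε h → Positive (sine (s + h) k))
    sine-stays-positive s k >0 with lipschitz s k
    ... | M , 0≤M , quotient with stays-positive >0 0≤M
    ...   | ε , ε>0 , ε≤1 , positive = ε , ε>0 , ε≤1 , near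
      where
      near : ∀ h → Within ε h → Positive (sine (s + h) k)
      near h w with quotient h (within-weaken ε≤1 w)
      ... | g , w′ , eq = pos-resp (sym eq) (positive h g w w′)

  opaque
    sine-stays-negative : ∀ s k → Positive (- sine s k) →
      ∃ λ ε → Positive ε × (ε ≤ 1#) × (∀ h → Within ε h → Positive (- sine (s + h) k))
    sine-stays-negative s k >0 with lipschitz s k
    ... | M , 0≤M , quotient with stays-positive >0 0≤M
    ...   | ε , ε>0 , ε≤1 , positive = ε , ε>0 , ε≤1 , near
      where
      near : ∀ h → Within ε h → Positive (- sine (s + h) k)
      near h w with quotient h (within-weaken ε≤1 w)
      ... | g , w′ , eq = pos-resp (begin
        - sine s k + h * - g   ≈⟨ solve 3 (λ x h g → :- x :+ h :* :- g := :- (x :+ h :* g)) refl (sine s k) h g ⟩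
        - (sine s k + h * g)   ≈⟨ -‿cong eq ⟨
        - sine (s + h) k       ∎) (positive h (- g) w (within-neg w′))

  smaller : ∀ {ε δ} → Positive ε → Positive δ → ∃ λ η → Positive η × (η ≤ ε) × (η ≤ δ)
  smaller {ε} {δ} ε>0 δ>0 with total ε δ
  ... | inj₁ ε≤δ = ε , ε>0 , ≤-refl , ε≤δ
  ... | inj₂ δ≤ε = δ , δ>0 , δ≤ε , ≤-refl

  -- Construction of 2 cos (π/n) for n ≥ 2

  module TwoCos (m : ℕ) where
    n : ℕ
    n = suc (suc m)

    -- Some term with index from 1 to n fails to be positive. The largest such t is 2 cos (π/n),
    -- where only the last term vanishes.
    NonPositive : Carrier → Set
    NonPositive t = ∃ λ k → k ℕ.< n × sine t (suc k) ≤ 0#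

    bounded : ∀ t → NonPositive t → t ≤ 1# + 1#
    bounded t (k , _ , ≤0) with total t (1# + 1#)
    ... | inj₁ t≤2 = t≤2
    ... | inj₂ 2≤t = ⊥-elim (proj₁ (sine-increasing 2≤t k) ≤0)

    0-nonPositive : NonPositive 0#
    -- The term of index 2 is t itself, and 2 ≤ n.
    0-nonPositive = 1 , ℕ.s≤s (ℕ.s≤s ℕ.z≤n) , ≤-reflexive (solve 0 (:0 :* :1 :- :0 := :0) refl)

    supremum : ∃ λ s → (∀ t → NonPositive t → t ≤ s) × (∀ u → (∀ t → NonPositive t → t ≤ u) → s ≤ u)
    supremum = complete NonPositive (0# , 0-nonPositive) (1# + 1# , bounded)

    τ : Carrier
    τ = proj₁ supremum

    τ-upper : ∀ t → NonPositive t → t ≤ τ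
    τ-upper = proj₁ (proj₂ supremum)

    τ-least : ∀ u → (∀ t → NonPositive t → t ≤ u) → τ ≤ u
    τ-least = proj₂ (proj₂ supremum)

    0≤τ : 0# ≤ τ
    0≤τ = τ-upper 0# 0-nonPositive

    -- A negative term would stay negative slightly to the right of τ, beyond the supremum.
    sine-≮0 : ∀ k → k ℕ.< n → ¬ Positive (- sine τ (suc k))
    sine-≮0 k k<n <0 with sine-stays-negative τ (suc k) <0
    ... | ε , ε>0 , _ , negative = ε>0 (0≤-⇒≤0 (≤-respʳ-≈
            (solve 2 (λ s ε → s :- (s :+ ε) := :- ε) refl τ ε)
            (≤⇒0≤- (τ-upper (τ + ε) (k , k<n , 0≤-⇒≤0 (pos⇒≥0 (negative ε (within-self (pos⇒≥0 ε>0)))))))))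

    sine-≥0 : ∀ k → k ℕ.< n → 0# ≤ sine τ (suc k)
    sine-≥0 k k<n with 0# ≤? sine τ (suc k)
    ... | yes ≥0 = ≥0
    ... | no ¬≥0 = ⊥-elim (sine-≮0 k k<n λ -x≤0 →
            ¬≥0 (≤-respʳ-≈ (solve 1 (λ x → :- :- x := x) refl (sine τ (suc k))) (≤0⇒0≤- -x≤0)))

    all-positive-near : ∀ l → (∀ k → k ℕ.< l → Positive (sine τ (suc k))) →
      ∃ λ ε → Positive ε × (∀ h → Within ε h → ∀ k → k ℕ.< l → Positive (sine (τ + h) (suc k)))
    all-positive-near zero    _   = 1# , 1-pos , λ _ _ _ ()
    all-positive-near (suc l) >0s
      with all-positive-near l (λ k k<l → >0s k (ℕ.m<n⇒m<1+n k<l)) | sine-stays-positive τ (suc l) (>0s l ℕ.≤-refl)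
    ... | ε , ε>0 , near | δ , δ>0 , _ , near-l with smaller ε>0 δ>0
    ...   | η , η>0 , η≤ε , η≤δ = η , η>0 , λ h w k k<1+l → choose h w k (ℕ.m<1+n⇒m<n∨m≡n k<1+l)
      where
      choose : ∀ h → Within η h → ∀ k → k ℕ.< l ⊎ k ≡ l → Positive (sine (τ + h) (suc k))
      choose h w k (inj₁ k<l)    = near h (within-weaken η≤ε w) k k<l
      choose h w k (inj₂ ≡.refl) = near-l h (within-weaken η≤δ w)

    -- Otherwise all terms stay positive on an interval [τ - ε, τ], and τ - ε is a smaller upper
    -- bound.
    not-all-positive : ¬ (∀ k → k ℕ.< n → Positive (sine τ (suc k)))
    not-all-positive >0s with all-positive-near n >0s
    ... | ε , ε>0 , near = ε>0 (0≤-⇒≤0 (≤-respʳ-≈ (solve 2 (λ s ε → s :- ε :- s := :- ε) refl τ ε)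
            (≤⇒0≤- (τ-least (τ - ε) below))))
      where
      below : ∀ t → NonPositive t → t ≤ τ - ε
      below t np@(k , k<n , ≤0) with total t (τ - ε)
      ... | inj₁ t≤ = t≤
      ... | inj₂ ≤t = ⊥-elim (near (t - τ)
              ( ≤-respʳ-≈ (solve 3 (λ s t ε → ε :+ (s :- t) := ε :- (t :- s)) refl τ t ε)
                  (0≤+ (pos⇒≥0 ε>0) (≤⇒0≤- (τ-upper t np)))
              , ≤-respʳ-≈ (solve 3 (λ s t ε → t :- (s :- ε) := ε :+ (t :- s)) refl τ t ε) (≤⇒0≤- ≤t))
              k k<n (≤-respˡ-≈ (sine-cong (solve 2 (λ s t → t := s :+ (t :- s)) refl τ t) (suc k)) ≤0))

    -- A zero at k + 1 would force sine τ (k + 2) = − sine τ k < 0.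
    sine-positive : ∀ k → suc k ℕ.< n → Positive (sine τ (suc k))
    sine-positive zero    _     = 1-pos
    sine-positive (suc k) 2+k<n ≤0 = sine-positive k (ℕ.<-trans ℕ.≤-refl 2+k<n) (0≤-⇒≤0 (≤-respʳ-≈ (begin
      τ * sine τ (suc (suc k)) - sine τ (suc k)  ≈⟨ +-congʳ (*-congˡ (antisym ≤0 (sine-≥0 (suc k) (ℕ.<-trans ℕ.≤-refl 2+k<n)))) ⟩
      τ * 0# - sine τ (suc k)                    ≈⟨ solve 2 (λ t x → t :* :0 :- x := :- x) refl τ _ ⟩
      - sine τ (suc k)                           ∎) (sine-≥0 (suc (suc k)) 2+k<n)))

    -- The earlier terms are positive by `sine-positive`, so a positive term here would contradict
    -- `not-all-positive`.
    sine-n : sine τ n ≈ 0#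
    sine-n with sine τ n ≤? 0#
    ... | yes ≤0 = antisym ≤0 (sine-≥0 (suc m) ℕ.≤-refl)
    ... | no  >0 = ⊥-elim (not-all-positive λ k k<n → go k (ℕ.m<1+n⇒m<n∨m≡n k<n))
      where
      go : ∀ k → k ℕ.< suc m ⊎ k ≡ suc m → Positive (sine τ (suc k))
      go k (inj₁ k<) = sine-positive k (ℕ.s≤s k<)
      go k (inj₂ ≡.refl) = >0

    τ<2 : Positive (1# + 1# - τ)
    τ<2 2-τ≤0 = proj₁ (sine-increasing (0≤-⇒≤ (≤-respʳ-≈ (solve 1 (λ t → :- (:1 :+ :1 :- t) := t :- (:1 :+ :1)) refl τ) (≤0⇒0≤- 2-τ≤0))) (suc m))
      (≤-reflexive sine-n)

  -- The affinely regular 2n-gon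

  module RegularPolygon (m : ℕ) (τ : Carrier)
    (0≤τ : 0# ≤ τ) (τ<2 : Positive (1# + 1# - τ))
    (sine-positive : ∀ k → suc k ℕ.< suc (suc m) → Positive (sine τ (suc k)))
    (sine-n : sine τ (suc (suc m)) ≈ 0#) where

    n : ℕ
    n = suc (suc m)

    -- The orbit of (0, 1) under the linear map (x, y) ↦ (y, τy - x), which is conjugate to the
    -- rotation by π/n.
    P : ℕ → Point R
    P k = sine τ k , sine τ (suc k)

    cross : ℕ → ℕ → Carrier
    cross k l = sine τ k * sine τ (suc l) - sine τ (suc k) * sine τ l

    cross-antisym : ∀ k l → cross k l ≈ - cross l k
    cross-antisym k l = solve 4 (λ p q r s → p :* s :- q :* r := :- (r :* q :- s :* p)) refl
      (sine τ k) (sine τ (suc k)) (sine τ l) (sine τ (suc l))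

    -- The step map has determinant 1.
    cross-suc : ∀ k l → cross (suc k) (suc l) ≈ cross k l
    cross-suc k l = solve 5 (λ t p q r s → q :* (t :* s :- r) :- (t :* q :- p) :* s := p :* s :- q :* r) refl
      τ (sine τ k) (sine τ (suc k)) (sine τ l) (sine τ (suc l))

    cross-shift : ∀ k d → cross k (k ℕ.+ d) ≈ cross 0 d
    cross-shift zero    d = refl
    cross-shift (suc k) d = trans (cross-suc k (k ℕ.+ d)) (cross-shift k d)

    -- `cross` depends only on the difference of its arguments, and k - i = j - l.
    cross-parallel-≤ : ∀ {i j k l} → i ℕ.≤ k → i ℕ.+ j ≡ k ℕ.+ l → cross i k ≈ cross l j
    cross-parallel-≤ {i} {j} {k} {l} i≤k i+j≡k+l = begin
      cross i k                 ≡⟨ ≡.cong (cross i) (ℕ.m+[n∸m]≡n i≤k) ⟨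
      cross i (i ℕ.+ (k ℕ.∸ i)) ≈⟨ cross-shift i (k ℕ.∸ i) ⟩
      cross 0 (k ℕ.∸ i)         ≈⟨ cross-shift l (k ℕ.∸ i) ⟨
      cross l (l ℕ.+ (k ℕ.∸ i)) ≡⟨ ≡.cong (cross l) (ℕ.+-cancelˡ-≡ i _ _ shifted) ⟩
      cross l j                 ∎
      where
      shifted : i ℕ.+ (l ℕ.+ (k ℕ.∸ i)) ≡ i ℕ.+ j
      shifted = ≡.trans (≡.cong (i ℕ.+_) (ℕ.+-comm l _)) (≡.trans (≡.sym (ℕ.+-assoc i _ l))
        (≡.trans (≡.cong (ℕ._+ l) (ℕ.m+[n∸m]≡n i≤k)) (≡.sym i+j≡k+l)))

    cross-parallel : ∀ {i j k l} → i ℕ.+ j ≡ k ℕ.+ l → cross i k ≈ cross l j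
    cross-parallel {i} {j} {k} {l} i+j≡k+l with ℕ.≤-total i k
    ... | inj₁ i≤k = cross-parallel-≤ i≤k i+j≡k+l
    ... | inj₂ k≤i = trans (cross-antisym i k)
            (trans (-‿cong (cross-parallel-≤ k≤i (≡.sym i+j≡k+l))) (sym (cross-antisym l j)))

    -- By bilinearity the determinant of the chord vectors is a sum of four `cross` terms, which
    -- cancel in pairs.
    chords-parallel : ∀ {i j k l} → i ℕ.+ j ≡ k ℕ.+ l → SameSlope R (P i) (P j) (P k) (P l)
    chords-parallel {i} {j} {k} {l} eq = -≈0⇒≈ (begin
      (sine τ j - sine τ i) * (sine τ (suc l) - sine τ (suc k)) - (sine τ (suc j) - sine τ (suc i)) * (sine τ l - sine τ k)
        ≈⟨ bilinear (sine τ i) (sine τ (suc i)) (sine τ j) (sine τ (suc j)) (sine τ k) (sine τ (suc k)) (sine τ l) (sine τ (suc l)) ⟩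
      cross i k - cross l j + (cross k j - cross i l)
        ≈⟨ +-cong (≈⇒-≈0 (cross-parallel {i} {j} {k} {l} eq))
                  (≈⇒-≈0 (sym (cross-parallel {i} {j} {l} {k} (≡.trans eq (ℕ.+-comm k l))))) ⟩
      0# + 0# ≈⟨ solve 0 (:0 :+ :0 := :0) refl ⟩
      0# ∎)
      where
      bilinear : ∀ i i′ j j′ k k′ l l′ → (j - i) * (l′ - k′) - (j′ - i′) * (l - k) ≈
        (i * k′ - i′ * k) - (l * j′ - l′ * j) + ((k * j′ - k′ * j) - (i * l′ - i′ * l))
      bilinear i i′ j j′ k k′ l l′ = trans
        (+-cong
          (solve 4 (λ i j k′ l′ → (j :- i) :* (l′ :- k′) := (i :* k′ :+ l′ :* j) :- (k′ :* j :+ i :* l′)) refl i j k′ l′)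
          (-‿cong (solve 4 (λ i′ j′ k l → (j′ :- i′) :* (l :- k) := (l :* j′ :+ i′ :* k) :- (k :* j′ :+ i′ :* l)) refl i′ j′ k l)))
        (solve 8 (λ a b c d e f g h → (a :+ b :- (c :+ d)) :- (e :+ f :- (g :+ h)) := (a :- f) :- (e :- b) :+ ((g :- c) :- (d :- h)))
          refl (i * k′) (l′ * j) (k′ * j) (i * l′) (l * j′) (i′ * k) (k * j′) (i′ * l))

    -- A quadratic form invariant under the step map, positive definite because 0 ≤ τ < 2.
    form : Point R → Carrier
    form (x , y) = x * x - τ * (x * y) + y * y

    form-cong : ∀ {p q} → p ≈ₚ q → form p ≈ form q
    form-cong (eq₁ , eq₂) = +-cong (+-cong (*-cong eq₁ eq₁) (-‿cong (*-congˡ (*-cong eq₁ eq₂)))) (*-cong eq₂ eq₂)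

    form-P : ∀ k → form (P k) ≈ 1#
    form-P zero    = solve 1 (λ t → :0 :* :0 :- t :* (:0 :* :1) :+ :1 :* :1 := :1) refl τ
    form-P (suc k) = trans (solve 3 (λ t x y →
        y :* y :- t :* (y :* (t :* y :- x)) :+ (t :* y :- x) :* (t :* y :- x) := x :* x :- t :* (x :* y) :+ y :* y)
      refl τ (sine τ k) (sine τ (suc k))) (form-P k)

    4-τ²-pos : Positive ((1# + 1# - τ) * (1# + 1# + τ))
    4-τ²-pos = pos*pos τ<2 (pos+nonneg 2-pos 0≤τ)

    square≈0 : ∀ x → x * x ≈ 0# → x ≈ 0#
    square≈0 x x²≈0 with x ≈0?
    ... | yes x≈0 = x≈0
    ... | no  x≉0 = *-cancel-0 x≉0 x²≈0

    -- Completing the square: 4 form(x, y) = (4 - τ²) y² + (2x - τy)².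
    form≈0 : ∀ x y → form (x , y) ≈ 0# → y ≈ 0#
    form≈0 x y eq with y ≈0?
    ... | yes y≈0 = y≈0
    ... | no  y≉0 = ⊥-elim (pos+nonneg
            (pos*pos 4-τ²-pos (λ y²≤0 → y≉0 (square≈0 y (antisym y²≤0 (0≤x² y)))))
            (0≤x² ((1# + 1#) * x - τ * y))
            (≤-reflexive (begin
              (1# + 1# - τ) * (1# + 1# + τ) * (y * y) + ((1# + 1#) * x - τ * y) * ((1# + 1#) * x - τ * y)
                ≈⟨ complete-square τ x y ⟩
              (1# + 1#) * (1# + 1#) * form (x , y) ≈⟨ *-congˡ eq ⟩
              (1# + 1#) * (1# + 1#) * 0#           ≈⟨ solve 0 ((:1 :+ :1) :* (:1 :+ :1) :* :0 := :0) refl ⟩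
              0# ∎)))
      where
      complete-square : ∀ t x y → (1# + 1# - t) * (1# + 1# + t) * (y * y) + ((1# + 1#) * x - t * y) * ((1# + 1#) * x - t * y)
        ≈ (1# + 1#) * (1# + 1#) * (x * x - t * (x * y) + y * y)
      complete-square = solve 3 (λ t x y →
        (:1 :+ :1 :- t) :* (:1 :+ :1 :+ t) :* (y :* y) :+ ((:1 :+ :1) :* x :- t :* y) :* ((:1 :+ :1) :* x :- t :* y)
        := (:1 :+ :1) :* (:1 :+ :1) :* (x :* x :- t :* (x :* y) :+ y :* y)) refl

    form-definite : ∀ x y → form (x , y) ≈ 0# → x ≈ 0# × y ≈ 0#
    form-definite x y eq = form≈0 y x (trans (solve 3 (λ t x y →
      y :* y :- t :* (y :* x) :+ x :* x := x :* x :- t :* (x :* y) :+ y :* y) refl τ x y) eq) , form≈0 x y eq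

    -- A line meets the conic form = 1 in at most two points.
    conic-chord : ∀ {t w p q} → form w ≈ 1# → form p ≈ 1# → form q ≈ 1# → ¬ p ≈ₚ q → Between t w p q → t ≈ 0# ⊎ t ≈ 1#
    conic-chord {t} {w} {p₁ , p₂} {q₁ , q₂} fw fp fq p≉q on with t ≈0?
    ... | yes t≈0 = inj₁ t≈0
    ... | no  t≉0 with (1# - t) ≈0?
    ...   | yes 1-t≈0 = inj₂ (sym (-≈0⇒≈ 1-t≈0))
    ...   | no  1-t≉0 = ⊥-elim (p≉q (sym (-≈0⇒≈ (proj₁ d≈0)) , sym (-≈0⇒≈ (proj₂ d≈0))))
      where
      -- Strict convexity of `form` as an identity. On three points of the conic the right side is
      -- zero, so t (1 - t) form(q - p) = 0.
      chord : ∀ τ t p₁ p₂ d₁ d₂ →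
        t * ((1# - t) * (d₁ * d₁ - τ * (d₁ * d₂) + d₂ * d₂)) ≈
        (1# - t) * (p₁ * p₁ - τ * (p₁ * p₂) + p₂ * p₂)
          + t * ((p₁ + d₁) * (p₁ + d₁) - τ * ((p₁ + d₁) * (p₂ + d₂)) + (p₂ + d₂) * (p₂ + d₂))
          - ((p₁ + t * d₁) * (p₁ + t * d₁) - τ * ((p₁ + t * d₁) * (p₂ + t * d₂)) + (p₂ + t * d₂) * (p₂ + t * d₂))
      chord = solve 6 (λ τ t p₁ p₂ d₁ d₂ →
        t :* ((:1 :- t) :* (d₁ :* d₁ :- τ :* (d₁ :* d₂) :+ d₂ :* d₂)) :=
        (:1 :- t) :* (p₁ :* p₁ :- τ :* (p₁ :* p₂) :+ p₂ :* p₂)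
          :+ t :* ((p₁ :+ d₁) :* (p₁ :+ d₁) :- τ :* ((p₁ :+ d₁) :* (p₂ :+ d₂)) :+ (p₂ :+ d₂) :* (p₂ :+ d₂))
          :- ((p₁ :+ t :* d₁) :* (p₁ :+ t :* d₁) :- τ :* ((p₁ :+ t :* d₁) :* (p₂ :+ t :* d₂)) :+ (p₂ :+ t :* d₂) :* (p₂ :+ t :* d₂))) refl
      back : ∀ p q → p + (q - p) ≈ q
      back = solve 2 (λ p q → p :+ (q :- p) := q) refl
      form-d≈0 : form (q₁ - p₁ , q₂ - p₂) ≈ 0#
      form-d≈0 = *-cancel-0 1-t≉0 (*-cancel-0 t≉0 (begin
        t * ((1# - t) * form (q₁ - p₁ , q₂ - p₂)) ≈⟨ chord τ t p₁ p₂ (q₁ - p₁) (q₂ - p₂) ⟩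
        (1# - t) * form (p₁ , p₂) + t * form (p₁ + (q₁ - p₁) , p₂ + (q₂ - p₂))
          - form (p₁ + t * (q₁ - p₁) , p₂ + t * (q₂ - p₂))
          ≈⟨ +-cong (+-cong (*-congˡ fp) (*-congˡ (trans (form-cong (back p₁ q₁ , back p₂ q₂)) fq)))
                    (-‿cong (trans (sym (form-cong on)) fw)) ⟩
        (1# - t) * 1# + t * 1# - 1# ≈⟨ solve 1 (λ t → (:1 :- t) :* :1 :+ t :* :1 :- :1 := :0) refl t ⟩
        0# ∎))
      d≈0 : (q₁ - p₁ ≈ 0#) × (q₂ - p₂ ≈ 0#)
      d≈0 = form-definite _ _ form-d≈0

    sine-1+n-negative : Positive (- sine τ (suc n))
    sine-1+n-negative = pos-resp (begin
      sine τ (suc m)                            ≈⟨ solve 2 (λ t x → x := :- (t :* :0 :- x)) refl τ (sine τ (suc m)) ⟩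
      - (τ * 0# - sine τ (suc m))               ≈⟨ -‿cong (+-congʳ (*-congˡ sine-n)) ⟨
      - (τ * sine τ n - sine τ (suc m))         ∎) (sine-positive m ℕ.≤-refl)

    -- `P n` = (0, x) lies on the conic, so x² = 1, and x is negative.
    sine-1+n : sine τ (suc n) ≈ - 1#
    sine-1+n = -≈0⇒≈ (*-cancel-0 {sine τ (suc n) - 1#} x-1≉0 (begin
      (x - 1#) * (x - - 1#)            ≈⟨ solve 2 (λ t x → (x :- :1) :* (x :- :- :1) := (:0 :* :0 :- t :* (:0 :* x) :+ x :* x) :- :1) refl τ x ⟩
      form (0# , x) - 1#               ≈⟨ +-congʳ (form-cong (sym sine-n , refl)) ⟩
      form (P n) - 1#                  ≈⟨ ≈⇒-≈0 (form-P n) ⟩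
      0#                               ∎))
      where
      x : Carrier
      x = sine τ (suc n)
      x-1≉0 : ¬ (sine τ (suc n) - 1# ≈ 0#)
      x-1≉0 eq = sine-1+n-negative (≤-respˡ-≈ (-‿cong (sym (-≈0⇒≈ eq)))
        (0≤-⇒≤0 (≤-respʳ-≈ (solve 0 (:1 := :- :- :1) refl) 0≤1)))

    -- Both sides satisfy the same recurrence and agree at 0 and 1.
    half-turn : ∀ k → sine τ (k ℕ.+ n) ≈ - sine τ k
    half-turn zero          = trans sine-n (solve 0 (:0 := :- :0) refl)
    half-turn (suc zero)    = sine-1+n
    half-turn (suc (suc k)) = trans (+-cong (*-congˡ (half-turn (suc k))) (-‿cong (half-turn k)))
      (solve 3 (λ t x y → t :* :- x :- :- y := :- (t :* x :- y)) refl τ (sine τ (suc k)) (sine τ k))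

    turn : ∀ k → sine τ (k ℕ.+ (n ℕ.+ n)) ≈ sine τ k
    turn k = begin
      sine τ (k ℕ.+ (n ℕ.+ n))  ≡⟨ ≡.cong (sine τ) (ℕ.+-assoc k n n) ⟨
      sine τ (k ℕ.+ n ℕ.+ n)    ≈⟨ half-turn (k ℕ.+ n) ⟩
      - sine τ (k ℕ.+ n)        ≈⟨ -‿cong (half-turn k) ⟩
      - - sine τ k              ≈⟨ solve 1 (λ x → :- :- x := x) refl (sine τ k) ⟩
      sine τ k                  ∎

    turns : ∀ q k → sine τ (k ℕ.+ q ℕ.* (n ℕ.+ n)) ≈ sine τ k
    turns zero    k = reflexive (≡.cong (sine τ) (ℕ.+-identityʳ k))
    turns (suc q) k = begin
      sine τ (k ℕ.+ (n ℕ.+ n ℕ.+ q ℕ.* (n ℕ.+ n))) ≡⟨ ≡.cong (sine τ) (ℕ.+-assoc k (n ℕ.+ n) _) ⟨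
      sine τ (k ℕ.+ (n ℕ.+ n) ℕ.+ q ℕ.* (n ℕ.+ n)) ≈⟨ turns q (k ℕ.+ (n ℕ.+ n)) ⟩
      sine τ (k ℕ.+ (n ℕ.+ n))                     ≈⟨ turn k ⟩
      sine τ k                                     ∎

    P-step-back : ∀ k l → P (suc k) ≈ₚ P (suc l) → P k ≈ₚ P l
    P-step-back k l (eq₁ , eq₂) = (begin
      sine τ k                                   ≈⟨ back (sine τ k) (sine τ (suc k)) ⟩
      τ * sine τ (suc k) - sine τ (suc (suc k))  ≈⟨ +-cong (*-congˡ eq₁) (-‿cong eq₂) ⟩
      τ * sine τ (suc l) - sine τ (suc (suc l))  ≈⟨ back (sine τ l) (sine τ (suc l)) ⟨
      sine τ l                                   ∎) , eq₁
      where
      back : ∀ x y → x ≈ τ * y - (τ * y - x)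
      back x y = solve 3 (λ t x y → x := t :* y :- (t :* y :- x)) refl τ x y

    -- The first coordinate is positive before n and, by `half-turn`, negative after n. At n it is
    -- zero again, but the second coordinate has changed sign.
    P-returns : ∀ d → suc d ℕ.< n ℕ.+ n → ¬ P 0 ≈ₚ P (suc d)
    P-returns d d<2n (eq₁ , eq₂) with ℕ.<-cmp (suc d) n
    ... | tri< d<n _ _      = sine-positive d d<n (≤-reflexive (sym eq₁))
    ... | tri≈ _ ≡.refl _   = sine-1+n-negative (≤-respˡ-≈ (-‿cong eq₂) (0≤-⇒≤0 (≤-respʳ-≈ (solve 0 (:1 := :- :- :1) refl) 0≤1)))
    ... | tri> _ _ n<d with ℕ.m≤n⇒∃[o]m+o≡n n<d
    ...   | r , eq = sine-positive r (ℕ.+-cancelʳ-< n (suc r) n (≡.subst (ℕ._< n ℕ.+ n) d≡ d<2n))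
                       (≤-reflexive (neg-injective (begin
                         - sine τ (suc r)      ≈⟨ half-turn (suc r) ⟨
                         sine τ (suc r ℕ.+ n)  ≡⟨ ≡.cong (sine τ) d≡ ⟨
                         sine τ (suc d)        ≈⟨ eq₁ ⟨
                         0#                    ≈⟨ solve 0 (:0 := :- :0) refl ⟩
                         - 0#                  ∎)))
      where
      d≡ : suc d ≡ suc r ℕ.+ n
      d≡ = ≡.trans (≡.sym eq) (≡.cong suc (ℕ.+-comm n r))

    P-distinct : ∀ k l → k ℕ.< l → l ℕ.< n ℕ.+ n → ¬ P k ≈ₚ P l
    P-distinct zero    (suc l) _   l<2n eq = P-returns l l<2n eq
    P-distinct (suc k) (suc l) k<l l<2n eq = P-distinct k l (ℕ.s<s⁻¹ k<l) (ℕ.<-trans ℕ.≤-refl l<2n) (P-step-back k l eq)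

    P-injective : ∀ {k l} → k ℕ.< n ℕ.+ n → l ℕ.< n ℕ.+ n → P k ≈ₚ P l → k ≡ l
    P-injective {k} {l} k< l< eq with ℕ.<-cmp k l
    ... | tri< k<l _ _ = ⊥-elim (P-distinct k l k<l l< eq)
    ... | tri≈ _ k≡l _ = k≡l
    ... | tri> _ _ l<k = ⊥-elim (P-distinct l k l<k k< (sym (proj₁ eq) , sym (proj₂ eq)))

    -- The parts alternate, so the index sum of an edge is 2 (i + j) + 1; modulo 2n it is determined
    -- by i + j modulo n, which leaves n slopes.
    index : Fin n ⊎ Fin n → ℕ
    index (inj₁ i) = toℕ i ℕ.+ toℕ i
    index (inj₂ j) = suc (toℕ j ℕ.+ toℕ j)

    index< : ∀ v → index v ℕ.< n ℕ.+ n
    index< (inj₁ i) = ℕ.+-mono-< (toℕ<n i) (toℕ<n i)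
    index< (inj₂ j) = ≡.subst (ℕ._≤ n ℕ.+ n) (≡.cong suc (ℕ.+-suc _ _)) (ℕ.+-mono-≤ (toℕ<n j) (toℕ<n j))

    double-injective : ∀ k l → k ℕ.+ k ≡ l ℕ.+ l → k ≡ l
    double-injective k l eq = ℕ.*-cancelˡ-≡ k l 2
      (≡.trans (≡.cong (k ℕ.+_) (ℕ.+-identityʳ k)) (≡.trans eq (≡.cong (l ℕ.+_) (≡.sym (ℕ.+-identityʳ l)))))

    even≢odd : ∀ k l → k ℕ.+ k ≢ suc (l ℕ.+ l)
    even≢odd (suc k) l eq = even≢odd l k (≡.sym (≡.trans (≡.sym (ℕ.+-suc k k)) (ℕ.suc-injective eq)))

    index-injective : ∀ v w → index v ≡ index w → v ≡ w
    index-injective (inj₁ i) (inj₁ i′) eq = ≡.cong inj₁ (toℕ-injective (double-injective _ _ eq))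
    index-injective (inj₁ i) (inj₂ j)  eq = ⊥-elim (even≢odd (toℕ i) (toℕ j) eq)
    index-injective (inj₂ j) (inj₁ i)  eq = ⊥-elim (even≢odd (toℕ i) (toℕ j) (≡.sym eq))
    index-injective (inj₂ j) (inj₂ j′) eq = ≡.cong inj₂ (toℕ-injective (double-injective _ _ (ℕ.suc-injective eq)))

    pos-injective : ∀ v w → P (index v) ≈ₚ P (index w) → v ≡ w
    pos-injective v w eq = index-injective v w (P-injective (index< v) (index< w) eq)

    -- Each chord's second endpoint is moved by as many full turns as the other chord's quotient.
    -- This makes the index sums equal as natural numbers, without subtraction.
    chords-parallel-mod : ∀ (i j i′ j′ : Fin n) → (toℕ i ℕ.+ toℕ j) ℕ.% n ≡ (toℕ i′ ℕ.+ toℕ j′) ℕ.% n →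
      SameSlope R (P (index (inj₁ i))) (P (index (inj₂ j))) (P (index (inj₁ i′))) (P (index (inj₂ j′)))
    chords-parallel-mod i j i′ j′ eq = begin
      (x J - x I) * (y J′ - y I′)    ≈⟨ *-cong (+-congʳ (turns q′ J)) (+-congʳ (turns q (suc J′))) ⟨
      (x (J ℕ.+ q′ ℕ.* (n ℕ.+ n)) - x I) * (y (J′ ℕ.+ q ℕ.* (n ℕ.+ n)) - y I′)
        ≈⟨ chords-parallel {I} {J ℕ.+ q′ ℕ.* (n ℕ.+ n)} {I′} {J′ ℕ.+ q ℕ.* (n ℕ.+ n)} sums ⟩
      (y (J ℕ.+ q′ ℕ.* (n ℕ.+ n)) - y I) * (x (J′ ℕ.+ q ℕ.* (n ℕ.+ n)) - x I′)
        ≈⟨ *-cong (+-congʳ (turns q′ (suc J))) (+-congʳ (turns q J′)) ⟩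
      (y J - y I) * (x J′ - x I′)    ∎
      where
      I J I′ J′ q q′ : ℕ
      I  = index (inj₁ i)
      J  = index (inj₂ j)
      I′ = index (inj₁ i′)
      J′ = index (inj₂ j′)
      q  = (toℕ i ℕ.+ toℕ j) ℕ./ n
      q′ = (toℕ i′ ℕ.+ toℕ j′) ℕ./ n
      x y : ℕ → Carrier
      x k = sine τ k
      y k = sine τ (suc k)
      regroup : ∀ i j q n → (i ℕ.+ i) ℕ.+ (suc (j ℕ.+ j) ℕ.+ q ℕ.* (n ℕ.+ n)) ≡ suc (2 ℕ.* (i ℕ.+ j ℕ.+ q ℕ.* n))
      regroup = solve-∀
      swap : ∀ r q q′ n → r ℕ.+ q ℕ.* n ℕ.+ q′ ℕ.* n ≡ r ℕ.+ q′ ℕ.* n ℕ.+ q ℕ.* n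
      swap = solve-∀
      sums : I ℕ.+ (J ℕ.+ q′ ℕ.* (n ℕ.+ n)) ≡ I′ ℕ.+ (J′ ℕ.+ q ℕ.* (n ℕ.+ n))
      sums = ≡.trans (regroup (toℕ i) (toℕ j) q′ n) (≡.trans (≡.cong (λ z → suc (2 ℕ.* z)) (
        ≡.trans (≡.cong (ℕ._+ q′ ℕ.* n) (ℕ.m≡m%n+[m/n]*n (toℕ i ℕ.+ toℕ j) n)) (
        ≡.trans (≡.cong (λ r → r ℕ.+ q ℕ.* n ℕ.+ q′ ℕ.* n) eq) (
        ≡.trans (swap ((toℕ i′ ℕ.+ toℕ j′) ℕ.% n) q q′ n)
        (≡.cong (ℕ._+ q ℕ.* n) (≡.sym (ℕ.m≡m%n+[m/n]*n (toℕ i′ ℕ.+ toℕ j′) n)))))))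
        (≡.sym (regroup (toℕ i′) (toℕ j′) q n)))

    slopeNumber≤ : SlopeNumber≤ R (K n n) n
    slopeNumber≤ = drawing (λ v → P (index v)) pos-injective
        (λ i j w t _ → conic-chord (form-P (index w)) (form-P (index (inj₁ i))) (form-P (index (inj₂ j)))
          λ eq → case pos-injective (inj₁ i) (inj₂ j) eq of λ ())
      , (λ { (i , j) → fromℕ< (ℕ.m%n<n (toℕ i ℕ.+ toℕ j) n) })
      , λ { (i , j) (i′ , j′) eq → chords-parallel-mod i j i′ j′
              (≡.trans (≡.sym (toℕ-fromℕ< _)) (≡.trans (≡.cong toℕ eq) (toℕ-fromℕ< _))) }

  -- The upper bounds for general parts

  slopeNumber≤-larger-part : ∀ a b → a ℕ.< b → SlopeNumber≤ R (K (suc a) b) b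
  -- The polygon has n ≥ 2, so the single edge is drawn inside the strip drawing of K(1, 2), which
  -- has one slope.
  slopeNumber≤-larger-part zero (suc zero) _ =
    restrict id (λ _ → zero) id (λ { {zero} {zero} _ → ≡.refl }) (Strip.slopeNumber≤ 0 1)
  slopeNumber≤-larger-part (suc a) (suc zero) (ℕ.s≤s ())
  slopeNumber≤-larger-part a (suc (suc m)) a<b =
    restrict (λ i → inject≤ i a<b) id (inject≤-injective a<b a<b _ _) id
      (RegularPolygon.slopeNumber≤ m τ 0≤τ τ<2 sine-positive sine-n)
    where open TwoCos m

  slopeNumber≤-strip : ∀ a b → SlopeNumber≤ R (K (suc a) b) (ℕ.⌈ b /2⌉ ℕ.+ a)
  slopeNumber≤-strip a b =
    restrict id (λ j → inject≤ j b≤2⌈b/2⌉) id (inject≤-injective b≤2⌈b/2⌉ b≤2⌈b/2⌉ _ _) (Strip.slopeNumber≤ a ℕ.⌈ b /2⌉)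
    where
    b≤2⌈b/2⌉ : b ℕ.≤ ℕ.⌈ b /2⌉ ℕ.+ ℕ.⌈ b /2⌉
    b≤2⌈b/2⌉ = ≡.subst (ℕ._≤ ℕ.⌈ b /2⌉ ℕ.+ ℕ.⌈ b /2⌉) (ℕ.⌊n/2⌋+⌈n/2⌉≡n b) (ℕ.+-monoˡ-≤ _ (ℕ.⌊n/2⌋≤⌈n/2⌉ b))

open import Data.Nat using (_≤_; _+_; _*_; _∸_; ⌈_/2⌉; _⊓_)

theorem2 : (R : CompleteOrderedField) → (a b : ℕ) → 1 ≤ a → a ≤ b →
    ((k : ℕ) → SlopeNumber≤ R (K a b) k → a + b ∸ 1 ≤ 2 * k) ×
    SlopeNumber≤ R (K a b) (b ⊓ (⌈ b /2⌉ + a ∸ 1))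
theorem2 R (suc a) b _ a<b = lower , upper (ℕ.⊓-sel b (⌈ b /2⌉ + suc a ∸ 1))
  where
  open Plane R

  lower : (k : ℕ) → SlopeNumber≤ R (K (suc a) b) k → a + b ≤ 2 * k
  lower k (D , slopes) = ≡.subst (a + b ≤_) (≡.cong (k +_) (≡.sym (ℕ.+-identityʳ k)))
    (LowerBound.bound D slopes a<b)

  -- The minimum is one of its two arguments, so each case is one of the constructions.
  upper : ∀ {c} → c ≡ b ⊎ c ≡ ⌈ b /2⌉ + suc a ∸ 1 → SlopeNumber≤ R (K (suc a) b) c
  upper (inj₁ ≡.refl) = slopeNumber≤-larger-part a b a<b
  upper (inj₂ ≡.refl) = ≡.subst (SlopeNumber≤ R (K (suc a) b)) (≡.cong (_∸ 1) (≡.sym (ℕ.+-suc ⌈ b /2⌉ a)))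
    (slopeNumber≤-strip a b)
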